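{- There is a fixed constant $\varepsilon_0>0$ such that the following holds. Suppose a streaming algorithm $\mathcal{A}$ solves the $\mathsf{AQ}(\varepsilon,\delta,n,U)$ problem in strict turnstile streams for some $\varepsilon\in(0,\varepsilon_0)$ and $\delta<1/10$. Then $\mathcal{A}$ must use at least $$\Omega\!\left(\varepsilon^{ -1}\,\log(\varepsilon n)\,\log\!\left(\frac{\varepsilon U}{\log(\varepsilon n)}\right)\right)$$ bits of memory.
   Context: In a strict turnstile stream over $[U]=\{1,\dots,U\}$, a vector $x$ starts at $0$ and receives updates $x_u\leftarrow x_u+\Delta$ ($\Delta$ may be negative; insertions and deletions of items), with $x_u\ge0$ for all $u$ at all times. Write $\mathrm{rank}(u)=\sum_{v\le u}x_v$. Approximate quantile problem $\mathsf{AQ}(\varepsilon,\delta,n,U)$: with $N=\lceil\|x\|_1\rceil$ the size of the database $x$ at the time of the query, each query $q\in[N]$ must be answered by an index $u\in[U]$ with $\mathrm{rank}(u)\ge q-\varepsilon N$ and $\mathrm{rank}(u-1)\le q+\varepsilon N$, with probability at least $1-\delta$ (for each query individually, over the randomness of the algorithm). The parameter $n$ is the database size the algorithm must be able to handle (streams in which the database size is at most $n$). The constant hidden in $\Omega(\cdot)$ is absolute.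
   Formalization: Proved for U ≥ 2 and εn > 1: for U = 1 always answering 1 needs no memory although the bound can be positive, and for εn ≤ 1 the bound is undefined. The algorithm's randomness is a uniform finite seed plus fresh uniform coins from a finite set. -}

module Defs where

open import Algebra.Definitions.RawSemiring using () renaming (_^_ to pow)
open import Data.Bool.Base using (Bool; if_then_else_)
open import Data.Empty using (⊥)
open import Data.Fin.Base using (Fin; toℕ)
open import Data.Integer.Base as ℤ using (ℤ; +_; -[1+_]; 0ℤ)
import Data.Integer.Properties as ℤₚ
open import Data.List.Base using (List; []; _∷_; _++_; foldl; length)
open import Data.List.Relation.Unary.All using (All)
open import Data.List.Relation.Unary.Unique.Propositional using (Unique)
open import Data.Nat.Base as ℕ using (ℕ; suc; NonZero)
import Data.Nat.Properties as ℕₚ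
open import Data.Product.Base using (Σ; ∃; ∃₂; _×_; _,_)
open import Data.Rational.Base as ℚ using (ℚ; 0ℚ; 1ℚ; ½; _/_; ↥_; ↧ₙ_; +-*-rawSemiring)
open import Data.Sum.Base using (_⊎_)
open import Data.Vec.Base as Vec using (Vec)
open import Data.Vec.Functional using (Vector; updateAt)
open import Function.Bundles using (_⇔_)
open import Relation.Binary.PropositionalEquality.Core using (_≡_)
open import Relation.Nullary.Decidable.Core using (⌊_⌋)
open import Relation.Nullary.Negation.Core using (¬_)
import Algebra.Properties.CommutativeMonoid.Sum as Sum

------------------------------------------------------------------------
-- Real numbers as two-sided Dedekind cuts.
--
-- `lower q` reads "q < x" and `upper q` reads "x < q".  The operations act
-- on bare pairs of predicates; whenever their arguments are reals
-- (`IsReal`) in the domain of the operation, they are the usual cuts of the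
-- result.

record Cut : Set₁ where
  field
    lower upper : ℚ → Set

open Cut public

record IsReal (x : Cut) : Set where
  field
    lower-inhabited : ∃ (lower x)
    upper-inhabited : ∃ (upper x)
    lower-rounded   : ∀ a → lower x a ⇔ (∃ λ b → a ℚ.< b × lower x b)
    upper-rounded   : ∀ a → upper x a ⇔ (∃ λ b → b ℚ.< a × upper x b)
    disjoint        : ∀ a → lower x a → upper x a → ⊥
    located         : ∀ {a b} → a ℚ.< b → lower x a ⊎ upper x b

infix 4 _<ᶜ_ _≤ᶜ_

_<ᶜ_ : Cut → Cut → Set
x <ᶜ y = ∃ λ a → upper x a × lower y a

_≤ᶜ_ : Cut → Cut → Set
x ≤ᶜ y = ¬ (y <ᶜ x)

fromℚ : ℚ → Cut
fromℚ r .lower a = a ℚ.< r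
fromℚ r .upper a = r ℚ.< a

fromℤ : ℤ → Cut
fromℤ i = fromℚ (i / 1)

fromℕ : ℕ → Cut
fromℕ k = fromℤ (+ k)

infixl 6 _⊕_ _⊖_
infixl 7 _⊗_ _⊘_

_⊕_ : Cut → Cut → Cut
(x ⊕ y) .lower a = ∃₂ λ b c → lower x b × lower y c × a ℚ.< b ℚ.+ c
(x ⊕ y) .upper a = ∃₂ λ b c → upper x b × upper y c × b ℚ.+ c ℚ.< a

_⊖_ : Cut → Cut → Cut
(x ⊖ y) .lower a = ∃₂ λ b c → lower x b × upper y c × a ℚ.< b ℚ.- c
(x ⊖ y) .upper a = ∃₂ λ b c → upper x b × lower y c × b ℚ.- c ℚ.< a

-- Interval multiplication: b < x < b′ and c < y < c′ confine x·y between the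
-- least and the greatest of the four products of end points.
_⊗_ : Cut → Cut → Cut
(x ⊗ y) .lower a =
  ∃₂ λ b b′ → ∃₂ λ c c′ →
    (lower x b × upper x b′ × lower y c × upper y c′) ×
    (a ℚ.< b ℚ.* c × a ℚ.< b ℚ.* c′ × a ℚ.< b′ ℚ.* c × a ℚ.< b′ ℚ.* c′)
(x ⊗ y) .upper a =
  ∃₂ λ b b′ → ∃₂ λ c c′ →
    (lower x b × upper x b′ × lower y c × upper y c′) ×
    (b ℚ.* c ℚ.< a × b ℚ.* c′ ℚ.< a × b′ ℚ.* c ℚ.< a × b′ ℚ.* c′ ℚ.< a)

-- The reciprocal of x; meaningful only for x > 0.
recip : Cut → Cut
recip x .lower a = ∃ λ b → 0ℚ ℚ.< b × upper x b × a ℚ.* b ℚ.< 1ℚ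
recip x .upper a = ∃ λ b → 0ℚ ℚ.< b × lower x b × 1ℚ ℚ.< a ℚ.* b

_⊘_ : Cut → Cut → Cut
x ⊘ y = x ⊗ recip y

infixr 8 _^_

_^_ : ℚ → ℕ → ℚ
_^_ = pow +-*-rawSemiring

2^_ : ℤ → ℚ
2^ (+ k)    = (+ 2 / 1) ^ k
2^ -[1+ k ] = ½ ^ suc k

-- The binary logarithm of z; meaningful only for z > 0.  For a rational
-- a = p/m with m > 0, and w > 0, the condition 2^a < w says 2^p < w^m.
log₂ : Cut → Cut
log₂ z .lower a = ∃ λ w → 0ℚ ℚ.< w × lower z w × 2^ (↥ a) ℚ.< w ^ (↧ₙ a)
log₂ z .upper a = ∃ λ w → 0ℚ ℚ.< w × upper z w × w ^ (↧ₙ a) ℚ.< 2^ (↥ a)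

------------------------------------------------------------------------
-- Strict turnstile streams.  The index i : Fin U stands for the item
-- suc (toℕ i) of [U] = {1,…,U}.

Update : ℕ → Set
Update U = Fin U × ℤ

Stream : ℕ → Set
Stream U = List (Update U)

freq : ∀ {U} → Stream U → Vector ℤ U
freq = foldl (λ { x (u , Δ) → updateAt x u (ℤ._+ Δ) }) (λ _ → 0ℤ)

‖_‖₁ : ∀ {U} → Vector ℤ U → ℕ
‖ x ‖₁ = Sum.sum ℕₚ.+-0-commutativeMonoid (λ u → ℤ.∣ x u ∣)

-- rank x k sums x over the items 1,…,k, so it makes sense for k = 0 too.
rank : ∀ {U} → Vector ℤ U → ℕ → ℤ
rank x k =
  Sum.sum ℤₚ.+-0-commutativeMonoid (λ v → if ⌊ toℕ v ℕₚ.<? k ⌋ then x v else 0ℤ)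

Admissible : ∀ {U} → ℕ → Stream U → Set
Admissible n σ =
  ∀ ρ τ → σ ≡ ρ ++ τ → (∀ u → 0ℤ ℤ.≤ freq ρ u) × ‖ freq ρ ‖₁ ℕ.≤ n

------------------------------------------------------------------------
-- Randomized streaming algorithms over [U] with S bits of memory.
--
-- The algorithm has a uniformly random read-only seed, fixed in advance and
-- not charged for, and a fresh uniformly random coin at every update and at
-- the query.  Coins survive a step only through the memory.

record Algorithm (U S : ℕ) : Set where
  field
    seeds coins : ℕ
    {{seeds≢0}} : NonZero seeds
    {{coins≢0}} : NonZero coins

  Seed = Fin seeds
  Coin = Fin coins
  Memory = Vec Bool S

  field
    initial : Seed → Memory
    step    : Seed → Coin → Update U → Memory → Memory
    answer  : Seed → Coin → ℕ → Memory → Fin U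

  run : Seed → (σ : Stream U) → Vec Coin (length σ) → Memory → Memory
  run s []      Vec.[]       m = m
  run s (e ∷ σ) (c Vec.∷ cs) m = run s σ cs (step s c e m)

  Outcome : Stream U → Set
  Outcome σ = Seed × Vec Coin (length σ) × Coin

  #outcomes : Stream U → ℕ
  #outcomes σ = seeds ℕ.* (coins ℕ.^ length σ ℕ.* coins)

  output : (σ : Stream U) → ℕ → Outcome σ → Fin U
  output σ q (s , cs , c) = answer s c q (run s σ cs (initial s))

-- Pr[E] ≥ p under the uniform distribution on a type Ω with `size` elements.
-- E need not be decidable, so a finite set of outcomes inside E is exhibited.
PrAtLeast : (Ω : Set) (size : ℕ) → (Ω → Set) → Cut → Set
PrAtLeast Ω size E p =
  Σ (List Ω) λ ωs → Unique ωs × All E ωs × p ⊗ fromℕ size ≤ᶜ fromℕ (length ωs)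

Correct : ∀ {U} → Cut → Vector ℤ U → ℕ → Fin U → Set
Correct ε x q u =
  fromℕ q ⊖ ε ⊗ fromℕ N ≤ᶜ fromℤ (rank x (suc (toℕ u))) ×
  fromℤ (rank x (toℕ u)) ≤ᶜ fromℕ q ⊕ ε ⊗ fromℕ N
  where N = ‖ x ‖₁

SolvesAQ : ∀ {S} (ε δ : Cut) (n U : ℕ) → Algorithm U S → Set
SolvesAQ ε δ n U A =
  ∀ σ → Admissible n σ → ∀ q → 1 ℕ.≤ q → q ℕ.≤ ‖ freq σ ‖₁ →
  PrAtLeast (Outcome σ) (#outcomes σ)
    (λ ω → Correct ε (freq σ) q (output σ q ω))
    (fromℕ 1 ⊖ δ)
  where open Algorithm A

-- A word over an alphabet of k letters is streamed to the algorithm, one item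
-- per letter: the t-th letter x becomes the x-th item of a block of k items of
-- its own, with a multiplicity exceeding a constant times ε times the total
-- multiplicity of the first t letters.  Whoever holds the memory after this
-- stream and knows the letters after the t-th one can delete their items; then
-- the answer to a single quantile query has to be exactly the item of x.  So
-- the memory determines each letter, given the later ones, with probability at
-- least 9/10.
--
-- For a fixed memory content, the sum of k^(number of correct guesses) over all
-- words of length T is at most (2k - 1)^T, since at most one letter is guessed
-- right at each position.  Averaged over the randomness, on the other hand, this
-- sum over words is by convexity at least k^T * k^(9T/10).  Comparing the two
-- gives 2^S ≥ k^(3T/10).  The multiplicities double every Θ(1/ε) letters, so
-- there is room for T = Θ(ε⁻¹ log (ε n)) letters, and k = Θ(U / T).

module Submission where

open import Data.Bool.Base using (Bool; true; false; if_then_else_)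
open import Data.Fin.Base using (Fin; zero; suc; toℕ)
open import Data.Fin.Properties using (toℕ<n; toℕ-injective; toℕ-fromℕ<)
open import Data.Integer.Base as ℤ using (ℤ; 0ℤ)
import Data.Integer.Properties as ℤ
open import Data.List.Base as List
  using (List; []; _∷_; _++_; length; replicate; drop; cartesianProductWith; allFin)
open import Data.List.Membership.Propositional using (_∈_)
open import Data.List.Membership.Propositional.Properties
  using (∈-cartesianProductWith⁺; ∈-cartesianProductWith⁻; ∈-allFin; ∈-∃++; ∈-++⁺ˡ; ∈-++⁺ʳ; ∈-++⁻; ∈-map⁻)
open import Data.List.Properties
  using (foldl-∷ʳ; ++-assoc; ++-identityʳ; length-++; length-map; length-replicate; length-tabulate)
open import Data.List.Relation.Unary.All as All using (All)
import Data.List.Relation.Unary.All.Properties as All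
open import Data.List.Relation.Unary.AllPairs using () renaming (_∷_ to _∷ᵘ_; [] to []ᵘ)
open import Data.List.Relation.Unary.Any using (here; there)
open import Data.List.Relation.Unary.Unique.Propositional using (Unique)
import Data.List.Relation.Unary.Unique.Propositional.Properties as Unique
open import Data.Nat.Base as ℕ using (ℕ)
open import Data.Nat.DivMod using (_mod_; m≡m%n+[m/n]*n; m%n<n; m<n⇒m%n≡m; m/n*n≤m)
import Data.Nat.Properties as ℕ
open import Data.Product.Base using (∃; ∃₂; _×_; _,_; proj₁; proj₂)
open import Data.Rational.Base as ℚ using (ℚ; 0ℚ; 1ℚ; toℚᵘ)
import Data.Rational.Properties as ℚ
open import Data.Rational.Unnormalised.Base as ℚᵘ using (mkℚᵘ)
import Data.Rational.Unnormalised.Properties as ℚᵘ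
open import Data.Sum.Base using (inj₁; inj₂)
open import Data.Vec.Base as Vec using (Vec)
open import Data.Vec.Functional using (Vector; updateAt)
open import Data.Vec.Functional.Properties using (updateAt-id-local; updateAt-updates; updateAt-minimal)
open import Data.Vec.Properties using (toList-injective; length-toList)
open import Data.Vec.Relation.Binary.Equality.Cast using (cast-is-id)
open import Defs hiding (_^_)
import Defs
open import Function.Bundles using (Equivalence)
open import Function.Definitions using (Injective)
open import Level using (0ℓ)
open import Relation.Binary.Definitions using (tri<; tri≈; tri>)
open import Relation.Binary.PropositionalEquality
  using (_≡_; refl; sym; trans; cong; cong₂; cong-app; subst; subst₂; module ≡-Reasoning)
open import Relation.Nullary.Decidable.Core using (Dec; yes; no; does; ⌊_⌋; from-yes; dec⇒maybe)
open import Relation.Nullary.Negation.Core using (contradiction; ¬_)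
import Algebra.Properties.CommutativeMonoid.Sum as Sum
import Algebra.Bundles
import Algebra.Properties.Semiring.Exp as Exp
import Data.Nat.Tactic.RingSolver as ℕ-Solver
import Tactic.RingSolver as RingSolver
import Tactic.RingSolver.Core.AlmostCommutativeRing as ACR

-- Each query may fail with constant probability, while the same memory content answers one query
-- per letter, and failures may be correlated arbitrarily. A union bound over the letters is out of
-- reach; only the mean number of correct guesses is controlled. The exponential moment fits this:
-- convexity needs nothing but the mean. Deletions use the true later letters, so a wrong guess
-- never spoils another one. The exponent 3/10 comes from the smallest alphabet. The moment is at
-- least k^(19T/10), and (2k - 1)^5 ≤ k^8 holds for every k used, barely so for k = 2 (243 against
-- 256); 19/10 - 8/5 = 3/10. Counting letters does not settle the real-valued bound. If log₂ (ε n)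
-- is close to 0, its reciprocal inflates the last logarithm; if ε U is below a constant, Θ(1/ε)
-- letters do not fit into U. Hence three regimes: log₂ (ε n) ≥ 1, log₂ (ε n) < 1, and the latter
-- with a small universe.

-- Finite sums and counting in lists.

module FiniteSums where

  open import Data.Nat.Base
  open import Data.Nat.Properties
  open import Data.Nat.Tactic.RingSolver using (solve-∀)

  private variable
    A B C : Set

  ∑ : List A → (A → ℕ) → ℕ
  ∑ []       f = 0
  ∑ (x ∷ xs) f = f x + ∑ xs f

  ∑-mono-∈ : ∀ {f g : A → ℕ} xs → (∀ {x} → x ∈ xs → f x ≤ g x) → ∑ xs f ≤ ∑ xs g
  ∑-mono-∈ []       _   = z≤n
  ∑-mono-∈ (x ∷ xs) f≤g = +-mono-≤ (f≤g (here refl)) (∑-mono-∈ xs (λ x∈xs → f≤g (there x∈xs)))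

  ∑-mono : ∀ {f g : A → ℕ} xs → (∀ x → f x ≤ g x) → ∑ xs f ≤ ∑ xs g
  ∑-mono xs f≤g = ∑-mono-∈ xs (λ {x} _ → f≤g x)

  ∑-cong : ∀ {f g : A → ℕ} xs → (∀ x → f x ≡ g x) → ∑ xs f ≡ ∑ xs g
  ∑-cong []       _   = refl
  ∑-cong (x ∷ xs) f≡g = cong₂ _+_ (f≡g x) (∑-cong xs f≡g)

  ∑-const : ∀ (xs : List A) c → ∑ xs (λ _ → c) ≡ length xs * c
  ∑-const []       c = refl
  ∑-const (x ∷ xs) c = cong (c +_) (∑-const xs c)

  ∑-+ : ∀ (xs : List A) f g → ∑ xs (λ x → f x + g x) ≡ ∑ xs f + ∑ xs g
  ∑-+ []       f g = refl
  ∑-+ (x ∷ xs) f g = begin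
    f x + g x + ∑ xs (λ x → f x + g x)  ≡⟨ cong (f x + g x +_) (∑-+ xs f g) ⟩
    f x + g x + (∑ xs f + ∑ xs g)       ≡⟨ interchange (f x) (g x) (∑ xs f) (∑ xs g) ⟩
    f x + ∑ xs f + (g x + ∑ xs g)       ∎
    where
    open ≡-Reasoning
    interchange : ∀ a b c d → a + b + (c + d) ≡ a + c + (b + d)
    interchange = solve-∀

  ∑-*ˡ : ∀ (xs : List A) c f → ∑ xs (λ x → c * f x) ≡ c * ∑ xs f
  ∑-*ˡ []       c f = sym (*-zeroʳ c)
  ∑-*ˡ (x ∷ xs) c f = begin
    c * f x + ∑ xs (λ x → c * f x)  ≡⟨ cong (c * f x +_) (∑-*ˡ xs c f) ⟩
    c * f x + c * ∑ xs f            ≡⟨ *-distribˡ-+ c (f x) _ ⟨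
    c * (f x + ∑ xs f)              ∎
    where open ≡-Reasoning

  ∑-swap : ∀ (xs : List A) (ys : List B) (f : A → B → ℕ) →
           ∑ xs (λ x → ∑ ys (f x)) ≡ ∑ ys (λ y → ∑ xs (λ x → f x y))
  ∑-swap []       ys f = sym (trans (∑-const ys 0) (*-zeroʳ (length ys)))
  ∑-swap (x ∷ xs) ys f = begin
    ∑ ys (f x) + ∑ xs (λ x → ∑ ys (f x))           ≡⟨ cong (∑ ys (f x) +_) (∑-swap xs ys f) ⟩
    ∑ ys (f x) + ∑ ys (λ y → ∑ xs (λ x → f x y))   ≡⟨ ∑-+ ys (f x) _ ⟨
    ∑ ys (λ y → f x y + ∑ xs (λ x → f x y))        ∎
    where open ≡-Reasoning

  ∑-++ : ∀ (xs ys : List A) f → ∑ (xs ++ ys) f ≡ ∑ xs f + ∑ ys f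
  ∑-++ []       ys f = refl
  ∑-++ (x ∷ xs) ys f = trans (cong (f x +_) (∑-++ xs ys f)) (sym (+-assoc (f x) _ _))

  ∑-map : ∀ (h : A → B) xs f → ∑ (List.map h xs) f ≡ ∑ xs (λ x → f (h x))
  ∑-map h []       f = refl
  ∑-map h (x ∷ xs) f = cong (f (h x) +_) (∑-map h xs f)

  ∑-cartesianProductWith : ∀ (h : A → B → C) xs ys f →
    ∑ (cartesianProductWith h xs ys) f ≡ ∑ xs (λ x → ∑ ys (λ y → f (h x y)))
  ∑-cartesianProductWith h []       ys f = refl
  ∑-cartesianProductWith h (x ∷ xs) ys f =
    trans (∑-++ (List.map (h x) ys) _ f)
          (cong₂ _+_ (∑-map (h x) ys f) (∑-cartesianProductWith h xs ys f))

  term≤∑ : ∀ {xs : List A} {x} f → x ∈ xs → f x ≤ ∑ xs f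
  term≤∑ f (here refl)  = m≤m+n _ _
  term≤∑ f (there x∈xs) = ≤-trans (term≤∑ f x∈xs) (m≤n+m _ _)

  𝟙 : ∀ {p} {P : Set p} → Dec P → ℕ
  𝟙 P? = if does P? then 1 else 0

  𝟙-true : ∀ {P : Set} (P? : Dec P) → P → 𝟙 P? ≡ 1
  𝟙-true (yes _) _ = refl
  𝟙-true (no ¬p) p = contradiction p ¬p

  𝟙-false : ∀ {P : Set} (P? : Dec P) → ¬ P → 𝟙 P? ≡ 0
  𝟙-false (yes p) ¬p = contradiction p ¬p
  𝟙-false (no _)  _  = refl

  -- `PrAtLeast` exhibits favourable outcomes as a duplicate-free list; this turns such a list into
  -- a lower bound for the count of a decidable event. The induction cuts the head of `xs` out of
  -- `ys` at one of its occurrences; uniqueness keeps the rest of `xs` inside what remains.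
  unique⇒length≤∑ : ∀ {P : A → Set} (P? : ∀ x → Dec (P x)) {xs ys : List A} →
    Unique xs → All P xs → (∀ {x} → x ∈ xs → x ∈ ys) → length xs ≤ ∑ ys (λ y → 𝟙 (P? y))
  unique⇒length≤∑ P? []ᵘ All.[] _ = z≤n
  unique⇒length≤∑ P? {x ∷ xs} {ys} (x∉xs ∷ᵘ u) (px All.∷ pxs) xs⊆ys
    with ∈-∃++ (xs⊆ys (here refl))
  ... | as , bs , refl = begin
    suc (length xs)                           ≤⟨ s≤s (unique⇒length≤∑ P? u pxs xs⊆as++bs) ⟩
    suc (∑ (as ++ bs) χ)                      ≡⟨ cong suc (∑-++ as bs χ) ⟩
    1 + (∑ as χ + ∑ bs χ)                     ≡⟨ cong (_+ (∑ as χ + ∑ bs χ)) (𝟙-true (P? x) px) ⟨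
    χ x + (∑ as χ + ∑ bs χ)                   ≡⟨ swap (χ x) (∑ as χ) (∑ bs χ) ⟩
    ∑ as χ + (χ x + ∑ bs χ)                   ≡⟨ ∑-++ as (x ∷ bs) χ ⟨
    ∑ (as ++ x ∷ bs) χ                        ∎
    where
    open ≤-Reasoning
    χ = λ y → 𝟙 (P? y)
    swap : ∀ a b c → a + (b + c) ≡ b + (a + c)
    swap = solve-∀
    xs⊆as++bs : ∀ {z} → z ∈ xs → z ∈ as ++ bs
    xs⊆as++bs z∈xs with ∈-++⁻ as (xs⊆ys (there z∈xs))
    ... | inj₁ z∈as          = ∈-++⁺ˡ z∈as
    ... | inj₂ (here refl)   = contradiction refl (All.lookup x∉xs z∈xs)
    ... | inj₂ (there z∈bs)  = ∈-++⁺ʳ as z∈bs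

  length-cartesianProductWith : ∀ (h : A → B → C) xs ys →
    length (cartesianProductWith h xs ys) ≡ length xs * length ys
  length-cartesianProductWith h []       ys = refl
  length-cartesianProductWith h (x ∷ xs) ys = trans (length-++ (List.map (h x) ys))
    (cong₂ _+_ (length-map (h x) ys) (length-cartesianProductWith h xs ys))

  words : List A → ℕ → List (List A)
  words xs zero    = [] ∷ []
  words xs (suc n) = cartesianProductWith _∷_ xs (words xs n)

  length-words : ∀ (xs : List A) n → length (words xs n) ≡ length xs ^ n
  length-words xs zero    = refl
  length-words xs (suc n) =
    trans (length-cartesianProductWith _∷_ xs (words xs n)) (cong (length xs *_) (length-words xs n))

  ∈-words⁻ : ∀ (xs : List A) n {w} → w ∈ words xs n → length w ≡ n
  ∈-words⁻ xs zero    (here refl) = refl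
  ∈-words⁻ xs (suc n) w∈ with ∈-cartesianProductWith⁻ _∷_ xs (words xs n) w∈
  ... | _ , _ , _ , v∈ , refl = cong suc (∈-words⁻ xs n v∈)

  ∈-words⁺ : ∀ {xs : List A} → (∀ x → x ∈ xs) → ∀ w → w ∈ words xs (length w)
  ∈-words⁺ all []      = here refl
  ∈-words⁺ all (x ∷ w) = ∈-cartesianProductWith⁺ _∷_ (all x) (∈-words⁺ all w)

-- The guessing game: exponential moments of the number of hits.

module GuessingGame where

  open import Data.Nat.Base
  open import Data.Nat.Properties
  open import Data.Nat.Tactic.RingSolver using (solve-∀)
  open FiniteSums

  bernoulli : ∀ κ d → 1 + κ * d ≤ suc κ ^ d
  bernoulli κ zero    = ≤-reflexive (cong suc (*-zeroʳ κ))
  bernoulli κ (suc d) = begin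
    1 + κ * suc d                ≤⟨ m≤m+n _ (κ * κ * d) ⟩
    1 + κ * suc d + κ * κ * d    ≡⟨ expand κ d ⟩
    suc κ * (1 + κ * d)          ≤⟨ *-monoʳ-≤ (suc κ) (bernoulli κ d) ⟩
    suc κ * suc κ ^ d            ∎
    where
    open ≤-Reasoning
    expand : ∀ κ d → 1 + κ * suc d + κ * κ * d ≡ suc κ * (1 + κ * d)
    expand = solve-∀

  -- The tangent-like bound a^g ≥ a^G (1 + κ (g - G)) for a = 1 + κ, with
  -- both sides moved so that no subtraction occurs.
  tangent : ∀ κ G g → suc κ ^ G * (1 + κ * g) ≤ suc κ ^ g + κ * G * suc κ ^ G
  tangent κ G g with ≤-total G g
  ... | inj₁ G≤g with m≤n⇒∃[o]m+o≡n G≤g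
  ...   | d , refl = begin
    a ^ G * (1 + κ * (G + d))              ≡⟨ split (a ^ G) κ G d ⟩
    a ^ G * (1 + κ * d) + κ * G * a ^ G    ≤⟨ +-monoˡ-≤ _ (*-monoʳ-≤ (a ^ G) (bernoulli κ d)) ⟩
    a ^ G * a ^ d + κ * G * a ^ G          ≡⟨ cong (_+ κ * G * a ^ G) (^-distribˡ-+-* a G d) ⟨
    a ^ (G + d) + κ * G * a ^ G            ∎
    where
    open ≤-Reasoning
    a = suc κ
    split : ∀ p κ G d → p * (1 + κ * (G + d)) ≡ p * (1 + κ * d) + κ * G * p
    split = solve-∀
  tangent κ G g | inj₂ g≤G with m≤n⇒∃[o]m+o≡n g≤G
  tangent κ G g | inj₂ g≤G | zero , refl = ≤-reflexive (begin
    suc κ ^ (g + 0) * (1 + κ * g)               ≡⟨ cong (λ h → suc κ ^ h * (1 + κ * g)) (+-identityʳ g) ⟩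
    suc κ ^ g * (1 + κ * g)                     ≡⟨ split (suc κ ^ g) κ g ⟩
    suc κ ^ g + κ * g * suc κ ^ g
      ≡⟨ cong (λ h → suc κ ^ g + κ * h * suc κ ^ h) (+-identityʳ g) ⟨
    suc κ ^ g + κ * (g + 0) * suc κ ^ (g + 0)   ∎)
    where
    open ≡-Reasoning
    split : ∀ p κ g → p * (1 + κ * g) ≡ p + κ * g * p
    split = solve-∀
  tangent zero G g | inj₂ g≤G | suc d , refl = ≤-reflexive (begin
    1 ^ (g + suc d) * 1         ≡⟨ *-identityʳ _ ⟩
    1 ^ (g + suc d)             ≡⟨ ^-zeroˡ (g + suc d) ⟩
    1                           ≡⟨ ^-zeroˡ g ⟨
    1 ^ g                       ≡⟨ +-identityʳ _ ⟨
    1 ^ g + 0                   ∎)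
    where open ≡-Reasoning
  tangent (suc κ) G g | inj₂ g≤G | suc d , refl = begin
    p * (1 + suc κ * g)                          ≤⟨ m≤m+n _ _ ⟩
    p * (1 + suc κ * g) + (κ + suc κ * d) * p    ≡⟨ regroup p κ g d ⟩
    suc κ * (g + suc d) * p                      ≤⟨ m≤n+m _ (suc (suc κ) ^ g) ⟩
    suc (suc κ) ^ g + suc κ * (g + suc d) * p    ∎
    where
    open ≤-Reasoning
    p = suc (suc κ) ^ (g + suc d)
    regroup : ∀ p κ g d → p * (1 + suc κ * g) + (κ + suc κ * d) * p ≡ suc κ * (g + suc d) * p
    regroup = solve-∀

  -- Jensen's inequality, with the line through the points `G` and `G + 1` of the exponential as
  -- support. The mean of `g` is at least `G + ρ / 10`, so `ρ` is the part of the mean beyond `G`,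
  -- in tenths.
  ∑-power-bound : ∀ {A : Set} κ G ρ (zs : List A) (g : A → ℕ) →
    (10 * G + ρ) * length zs ≤ 10 * ∑ zs g →
    suc κ ^ G * length zs * (10 + κ * ρ) ≤ 10 * ∑ zs (λ z → suc κ ^ g z)
  ∑-power-bound κ G ρ zs g many = +-cancelʳ-≤ (κ * G * p * 10 * n) _ _ (begin
    p * n * (10 + κ * ρ) + κ * G * p * 10 * n             ≡⟨ regroup₁ p n κ ρ G ⟩
    p * (10 * n + κ * ((10 * G + ρ) * n))
      ≤⟨ *-monoʳ-≤ p (+-monoʳ-≤ (10 * n) (*-monoʳ-≤ κ many)) ⟩
    p * (10 * n + κ * (10 * ∑ zs g))                      ≡⟨ regroup₂ p n κ (∑ zs g) ⟩
    10 * (p * (n + κ * ∑ zs g))                           ≡⟨ cong (10 *_) summed ⟨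
    10 * ∑ zs (λ z → p * (1 + κ * g z))
      ≤⟨ *-monoʳ-≤ 10 (∑-mono zs (λ z → tangent κ G (g z))) ⟩
    10 * ∑ zs (λ z → suc κ ^ g z + κ * G * p)             ≡⟨ cong (10 *_) (∑-+ zs _ _) ⟩
    10 * (∑ zs (λ z → suc κ ^ g z) + ∑ zs (λ _ → κ * G * p))
      ≡⟨ cong (λ c → 10 * (∑ zs (λ z → suc κ ^ g z) + c)) (∑-const zs _) ⟩
    10 * (∑ zs (λ z → suc κ ^ g z) + n * (κ * G * p))
      ≡⟨ regroup₃ (∑ zs (λ z → suc κ ^ g z)) n (κ * G * p) ⟩
    10 * ∑ zs (λ z → suc κ ^ g z) + κ * G * p * 10 * n    ∎)
    where
    open ≤-Reasoning
    p = suc κ ^ G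
    n = length zs
    summed : ∑ zs (λ z → p * (1 + κ * g z)) ≡ p * (n + κ * ∑ zs g)
    summed = trans (∑-*ˡ zs p _) (cong (p *_) (trans (∑-+ zs _ _)
      (cong₂ _+_ (trans (∑-const zs 1) (*-identityʳ n)) (∑-*ˡ zs κ g))))
    regroup₁ : ∀ p n κ ρ G → p * n * (10 + κ * ρ) + κ * G * p * 10 * n ≡ p * (10 * n + κ * ((10 * G + ρ) * n))
    regroup₁ = solve-∀
    regroup₂ : ∀ p n κ s → p * (10 * n + κ * (10 * s)) ≡ 10 * (p * (n + κ * s))
    regroup₂ = solve-∀
    regroup₃ : ∀ s n q → 10 * (s + n * q) ≡ 10 * s + q * 10 * n
    regroup₃ = solve-∀

  -- A word is revealed from its last letter to its first.  Each letter is
  -- encoded as a number by `code`, which may depend on the letters after it,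
  -- and a strategy guesses that number from the letters after it.
  module _ {κ} (code : List (Fin (suc κ)) → Fin (suc κ) → ℕ)
               (code-injective : ∀ w → Injective _≡_ _≡_ (code w)) where

    private
      k = suc κ
      Σᵏ = allFin k

    hits : (List (Fin k) → ℕ) → List (Fin k) → ℕ
    hits guess []      = 0
    hits guess (x ∷ w) = 𝟙 (guess w ≟ code w x) + hits guess w

    private
      ∑-hit≤1 : ∀ y w {xs} → Unique xs → ∑ xs (λ x → 𝟙 (y ≟ code w x)) ≤ 1
      ∑-hit≤1 y w {[]}     []ᵘ        = z≤n
      ∑-hit≤1 y w {x ∷ xs} (x∉ ∷ᵘ u) = split (y ≟ code w x)
        where
        split : (d : Dec (y ≡ code w x)) → 𝟙 d + ∑ xs (λ z → 𝟙 (y ≟ code w z)) ≤ 1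
        split (no _)     = ∑-hit≤1 y w {xs} u
        split (yes refl) = s≤s (≤-trans (∑-mono-∈ xs others) (≤-reflexive (trans (∑-const xs 0) (*-zeroʳ (length xs)))))
          where
          others : ∀ {z} → z ∈ xs → 𝟙 (code w x ≟ code w z) ≤ 0
          others z∈ = ≤-reflexive (𝟙-false (_ ≟ _) (λ eq → All.lookup x∉ z∈ (code-injective w eq)))

      ∑-letter : ∀ y w → ∑ Σᵏ (λ x → k ^ 𝟙 (y ≟ code w x)) ≤ k + κ
      ∑-letter y w = begin
        ∑ Σᵏ (λ x → k ^ 𝟙 (y ≟ code w x))             ≡⟨ ∑-cong Σᵏ (λ x → linear (y ≟ code w x)) ⟩
        ∑ Σᵏ (λ x → 1 + κ * 𝟙 (y ≟ code w x))         ≡⟨ ∑-+ Σᵏ (λ _ → 1) (λ x → κ * 𝟙 (y ≟ code w x)) ⟩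
        ∑ Σᵏ (λ _ → 1) + ∑ Σᵏ (λ x → κ * 𝟙 (y ≟ code w x))
          ≡⟨ cong₂ _+_ (trans (∑-const Σᵏ 1) (trans (*-identityʳ _) (length-tabulate (λ (x : Fin k) → x)))) (∑-*ˡ Σᵏ κ _) ⟩
        k + κ * ∑ Σᵏ (λ x → 𝟙 (y ≟ code w x))
          ≤⟨ +-monoʳ-≤ k (*-monoʳ-≤ κ (∑-hit≤1 y w (Unique.allFin⁺ k))) ⟩
        k + κ * 1                                     ≡⟨ cong (k +_) (*-identityʳ κ) ⟩
        k + κ                                         ∎
        where
        open ≤-Reasoning
        linear : ∀ {P : Set} (P? : Dec P) → k ^ 𝟙 P? ≡ 1 + κ * 𝟙 P?
        linear (yes _) = cong suc refl
        linear (no  _) = sym (cong suc (*-zeroʳ κ))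

    -- The guess for the head letter depends on the tail `w` alone. For fixed `w` the sum over the
    -- head therefore factors into `k ^ hits guess w` and a sum with at most one term `k` and all
    -- other terms 1.
    ∑-hits : ∀ guess T → ∑ (words Σᵏ T) (λ w → k ^ hits guess w) ≤ (k + κ) ^ T
    ∑-hits guess zero    = s≤s z≤n
    ∑-hits guess (suc T) = begin
      ∑ (words Σᵏ (suc T)) (λ w → k ^ hits guess w)
        ≡⟨ ∑-cartesianProductWith _∷_ Σᵏ (words Σᵏ T) _ ⟩
      ∑ Σᵏ (λ x → ∑ (words Σᵏ T) (λ w → k ^ (𝟙 (guess w ≟ code w x) + hits guess w)))
        ≡⟨ ∑-swap Σᵏ (words Σᵏ T) _ ⟩
      ∑ (words Σᵏ T) (λ w → ∑ Σᵏ (λ x → k ^ (𝟙 (guess w ≟ code w x) + hits guess w)))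
        ≤⟨ ∑-mono (words Σᵏ T) bound ⟩
      ∑ (words Σᵏ T) (λ w → (k + κ) * k ^ hits guess w)
        ≡⟨ ∑-*ˡ (words Σᵏ T) (k + κ) _ ⟩
      (k + κ) * ∑ (words Σᵏ T) (λ w → k ^ hits guess w)
        ≤⟨ *-monoʳ-≤ (k + κ) (∑-hits guess T) ⟩
      (k + κ) * (k + κ) ^ T  ∎
      where
      open ≤-Reasoning
      bound : ∀ w → ∑ Σᵏ (λ x → k ^ (𝟙 (guess w ≟ code w x) + hits guess w)) ≤ (k + κ) * k ^ hits guess w
      bound w = begin
        ∑ Σᵏ (λ x → k ^ (𝟙 (guess w ≟ code w x) + hits guess w))
          ≡⟨ ∑-cong Σᵏ (λ x → trans (^-distribˡ-+-* k (𝟙 (guess w ≟ code w x)) (hits guess w)) (*-comm _ (k ^ hits guess w))) ⟩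
        ∑ Σᵏ (λ x → k ^ hits guess w * k ^ 𝟙 (guess w ≟ code w x))
          ≡⟨ ∑-*ˡ Σᵏ (k ^ hits guess w) _ ⟩
        k ^ hits guess w * ∑ Σᵏ (λ x → k ^ 𝟙 (guess w ≟ code w x))
          ≤⟨ *-monoʳ-≤ (k ^ hits guess w) (∑-letter (guess w) w) ⟩
        k ^ hits guess w * (k + κ)
          ≡⟨ *-comm (k ^ hits guess w) (k + κ) ⟩
        (k + κ) * k ^ hits guess w ∎

    -- A fixed outcome together with a fixed message is one deterministic strategy, to which
    -- `∑-hits` applies. The message varies with the word, so `each` enlarges its term to the sum
    -- over all messages; this is where the factor `length messages` arises.
    message-bound : ∀ {A B : Set} (Ω : List A) (messages : List B) → (∀ m → m ∈ messages) →
      (encode : A → List (Fin k) → B) (guess : A → B → List (Fin k) → ℕ) →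
      ∀ T G ρ → 9 * T ≡ 10 * G + ρ → .{{NonZero (length Ω)}} →
      (∀ w → length w ≡ T → 9 * T * length Ω ≤ 10 * ∑ Ω (λ ω → hits (guess ω (encode ω w)) w)) →
      k ^ G * k ^ T * (10 + κ * ρ) ≤ 10 * (length messages * (k + κ) ^ T)
    message-bound {A} Ω messages complete encode guess T G ρ 9T≡ often =
      *-cancelˡ-≤ (length Ω) (begin
        length Ω * (k ^ G * k ^ T * (10 + κ * ρ))        ≡⟨ regroup₁ (length Ω) (k ^ G) (k ^ T) _ ⟩
        k ^ G * (length Ω * k ^ T) * (10 + κ * ρ)
          ≡⟨ cong (λ l → k ^ G * l * (10 + κ * ρ)) (trans length-plays (cong (length Ω *_) length-W)) ⟨
        k ^ G * length plays * (10 + κ * ρ)              ≤⟨ ∑-power-bound κ G ρ plays score enough ⟩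
        10 * ∑ plays (λ z → k ^ score z)
          ≡⟨ cong (10 *_) (∑-cartesianProductWith _,_ Ω W _) ⟩
        10 * ∑ Ω (λ ω → ∑ W (λ w → k ^ score (ω , w)))   ≤⟨ *-monoʳ-≤ 10 (∑-mono Ω each) ⟩
        10 * ∑ Ω (λ _ → length messages * (k + κ) ^ T)   ≡⟨ cong (10 *_) (∑-const Ω _) ⟩
        10 * (length Ω * (length messages * (k + κ) ^ T)) ≡⟨ regroup₂ (length Ω) _ ⟩
        length Ω * (10 * (length messages * (k + κ) ^ T)) ∎)
      where
      open ≤-Reasoning
      W = words Σᵏ T
      plays = cartesianProductWith _,_ Ω W
      score : A × List (Fin k) → ℕ
      score (ω , w) = hits (guess ω (encode ω w)) w
      length-W : length W ≡ k ^ T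
      length-W = trans (length-words Σᵏ T) (cong (_^ T) (length-tabulate (λ (x : Fin k) → x)))
      length-plays : length plays ≡ length Ω * length W
      length-plays = length-cartesianProductWith _,_ Ω W
      enough : (10 * G + ρ) * length plays ≤ 10 * ∑ plays score
      enough = begin
        (10 * G + ρ) * length plays             ≡⟨ cong₂ _*_ (sym 9T≡) length-plays ⟩
        9 * T * (length Ω * length W)           ≡⟨ regroup₃ (9 * T) (length Ω) (length W) ⟩
        length W * (9 * T * length Ω)           ≡⟨ ∑-const W _ ⟨
        ∑ W (λ _ → 9 * T * length Ω)            ≤⟨ ∑-mono-∈ W (λ {w} w∈ → often w (∈-words⁻ Σᵏ T w∈)) ⟩
        ∑ W (λ w → 10 * ∑ Ω (λ ω → score (ω , w)))   ≡⟨ ∑-*ˡ W 10 _ ⟩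
        10 * ∑ W (λ w → ∑ Ω (λ ω → score (ω , w)))   ≡⟨ cong (10 *_) (∑-swap W Ω _) ⟩
        10 * ∑ Ω (λ ω → ∑ W (λ w → score (ω , w)))
          ≡⟨ cong (10 *_) (∑-cartesianProductWith _,_ Ω W score) ⟨
        10 * ∑ plays score                      ∎
        where
        regroup₃ : ∀ a b c → a * (b * c) ≡ c * (a * b)
        regroup₃ = solve-∀
      each : ∀ ω → ∑ W (λ w → k ^ score (ω , w)) ≤ length messages * (k + κ) ^ T
      each ω = begin
        ∑ W (λ w → k ^ score (ω , w))
          ≤⟨ ∑-mono W (λ w → term≤∑ (λ m → k ^ hits (guess ω m) w) (complete (encode ω w))) ⟩
        ∑ W (λ w → ∑ messages (λ m → k ^ hits (guess ω m) w))
          ≡⟨ ∑-swap W messages _ ⟩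
        ∑ messages (λ m → ∑ W (λ w → k ^ hits (guess ω m) w))
          ≤⟨ ∑-mono messages (λ m → ∑-hits (guess ω m) T) ⟩
        ∑ messages (λ _ → (k + κ) ^ T)
          ≡⟨ ∑-const messages _ ⟩
        length messages * (k + κ) ^ T ∎
      regroup₁ : ∀ n a b c → n * (a * b * c) ≡ a * (n * b) * c
      regroup₁ = solve-∀
      regroup₂ : ∀ n a → 10 * (n * a) ≡ n * (10 * a)
      regroup₂ = solve-∀

-- Integer multiplicities of controlled geometric growth.

module Weights (m : ℕ) {{_ : ℕ.NonZero m}} where

  open import Data.Nat.Base
  open import Data.Nat.Properties
  open import Data.Nat.Tactic.RingSolver using (solve-∀)

  -- Each weight exceeds 1/m of the sum of all earlier ones.
  weightSum : ℕ → ℕ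
  weightSum zero    = 0
  weightSum (suc i) = weightSum i + suc (weightSum i / m)

  weight : ℕ → ℕ
  weight i = suc (weightSum i / m)

  weightSum<m*weight : ∀ i → weightSum i < m * weight i
  weightSum<m*weight i = begin-strict
    V                  ≡⟨ m≡m%n+[m/n]*n V m ⟩
    V % m + V / m * m  <⟨ +-monoˡ-< (V / m * m) (m%n<n V m) ⟩
    m + V / m * m      ≡⟨ *-comm (weight i) m ⟩
    m * weight i       ∎
    where
    open ≤-Reasoning
    V = weightSum i

  private
    -- One step multiplies `weightSum + m` by at most 1 + 1/m, which is at most (d + 1)/d because
    -- `d ≤ m`. The product of these fractions telescopes to `m / d`.
    growth : ∀ i d s → d + s ≡ m → d * (weightSum (i + s) + m) ≤ m * (weightSum i + m)
    growth i d zero    d≡m = ≤-reflexive (cong₂ (λ a b → a * (weightSum b + m))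
                                                (trans (sym (+-identityʳ d)) d≡m) (+-identityʳ i))
    growth i d (suc s) d+s≡m = *-cancelˡ-≤ m (begin
      m * (d * (weightSum (i + suc s) + m))     ≡⟨ cong (λ j → m * (d * (weightSum j + m))) (+-suc i s) ⟩
      m * (d * (V + suc (V / m) + m))           ≡⟨ regroup₁ m d V (V / m) ⟩
      d * (m * V + V / m * m + m + m * m)
        ≤⟨ *-monoʳ-≤ d (+-monoˡ-≤ (m * m) (+-monoˡ-≤ m (+-monoʳ-≤ (m * V) (m/n*n≤m V m)))) ⟩
      d * (m * V + V + m + m * m)               ≡⟨ regroup₂ m d V ⟩
      (d * m + d) * (V + m)                     ≤⟨ *-monoˡ-≤ (V + m) (+-monoʳ-≤ (d * m) d≤m) ⟩
      (d * m + m) * (V + m)                     ≡⟨ regroup₃ m d V ⟩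
      m * (suc d * (V + m))
        ≤⟨ *-monoʳ-≤ m (growth i (suc d) s (trans (sym (+-suc d s)) d+s≡m)) ⟩
      m * (m * (weightSum i + m))               ∎)
      where
      open ≤-Reasoning
      V = weightSum (i + s)
      d≤m : d ≤ m
      d≤m = subst (d ≤_) d+s≡m (m≤m+n d (suc s))
      regroup₁ : ∀ m d V q → m * (d * (V + suc q + m)) ≡ d * (m * V + q * m + m + m * m)
      regroup₁ = solve-∀
      regroup₂ : ∀ m d V → d * (m * V + V + m + m * m) ≡ (d * m + d) * (V + m)
      regroup₂ = solve-∀
      regroup₃ : ∀ m d V → (d * m + m) * (V + m) ≡ m * (suc d * (V + m))
      regroup₃ = solve-∀

  weightSum-doubling : ∀ M .{{_ : NonZero M}} → M + M ≡ m → ∀ L → weightSum (L * M) + m ≤ 2 ^ L * m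
  weightSum-doubling M 2M≡m zero    = ≤-reflexive (sym (+-identityʳ m))
  weightSum-doubling M 2M≡m (suc L) = begin
    weightSum (M + L * M) + m     ≡⟨ cong (λ j → weightSum j + m) (+-comm M (L * M)) ⟩
    weightSum (L * M + M) + m     ≤⟨ *-cancelˡ-≤ M doubled ⟩
    2 * (weightSum (L * M) + m)   ≤⟨ *-monoʳ-≤ 2 (weightSum-doubling M 2M≡m L) ⟩
    2 * (2 ^ L * m)               ≡⟨ *-assoc 2 (2 ^ L) m ⟨
    2 * 2 ^ L * m                 ∎
    where
    open ≤-Reasoning
    doubled : M * (weightSum (L * M + M) + m) ≤ M * (2 * (weightSum (L * M) + m))
    doubled = begin
      -- Half of `m` steps give `m / d = 2`.
      M * (weightSum (L * M + M) + m)    ≤⟨ growth (L * M) M M 2M≡m ⟩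
      m * (weightSum (L * M) + m)        ≡⟨ cong (_* (weightSum (L * M) + m)) 2M≡m ⟨
      (M + M) * (weightSum (L * M) + m)  ≡⟨ regroup M (weightSum (L * M) + m) ⟩
      M * (2 * (weightSum (L * M) + m))  ∎
      where
      regroup : ∀ M a → (M + M) * a ≡ M * (2 * a)
      regroup = solve-∀

-- Streams through nonnegative states, and words encoded as streams.

module StreamStates where

  open import Data.Integer.Base using (+_)
  open import Data.Nat.Base
  open import Data.Nat.Properties

  private variable
    U n : ℕ

  total : Vector ℕ U → ℕ
  total = Sum.sum +-0-commutativeMonoid

  bump : Vector ℕ U → Fin U → ℕ → Vector ℕ U
  bump y u w = updateAt y u (_+ w)

  total-bump : ∀ (y : Vector ℕ U) u w → total (bump y u w) ≡ total y + w
  total-bump {suc U} y zero    w = begin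
    y zero + w + total (λ v → y (suc v))    ≡⟨ +-assoc (y zero) w _ ⟩
    y zero + (w + total (λ v → y (suc v)))  ≡⟨ cong (λ t → y zero + t) (+-comm w _) ⟩
    y zero + (total (λ v → y (suc v)) + w)  ≡⟨ +-assoc (y zero) _ w ⟨
    total y + w                             ∎
    where open ≡-Reasoning
  total-bump {suc U} y (suc u) w =
    trans (cong (λ t → y zero + t) (total-bump (λ v → y (suc v)) u w)) (sym (+-assoc (y zero) _ w))

  updateAt-insert : ∀ {x : Vector ℤ U} {y : Vector ℕ U} → (∀ v → x v ≡ + y v) →
    ∀ u w v → updateAt x u (ℤ._+ + w) v ≡ + bump y u w v
  updateAt-insert {suc U} x≡y zero    w zero    = cong (ℤ._+ + w) (x≡y zero)
  updateAt-insert {suc U} x≡y zero    w (suc v) = x≡y (suc v)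
  updateAt-insert {suc U} x≡y (suc u) w zero    = x≡y zero
  updateAt-insert {suc U} x≡y (suc u) w (suc v) = updateAt-insert (λ v → x≡y (suc v)) u w v

  updateAt-delete : ∀ {x : Vector ℤ U} {y : Vector ℕ U} u w → (∀ v → x v ≡ + bump y u w v) →
    ∀ v → updateAt x u (ℤ._+ (ℤ.- + w)) v ≡ + y v
  updateAt-delete {suc U} {x} {y} zero    w x≡y zero    = begin
    x zero ℤ.+ ℤ.- + w            ≡⟨ cong (ℤ._+ ℤ.- + w) (x≡y zero) ⟩
    + (y zero + w) ℤ.+ ℤ.- + w    ≡⟨ ℤ.+-assoc (+ y zero) (+ w) (ℤ.- + w) ⟩
    + y zero ℤ.+ (+ w ℤ.- + w)    ≡⟨ cong (λ t → + y zero ℤ.+ t) (ℤ.+-inverseʳ (+ w)) ⟩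
    + y zero ℤ.+ 0ℤ               ≡⟨ ℤ.+-identityʳ (+ y zero) ⟩
    + y zero                      ∎
    where open ≡-Reasoning
  updateAt-delete {suc U} zero    w x≡y (suc v) = x≡y (suc v)
  updateAt-delete {suc U} (suc u) w x≡y zero    = x≡y zero
  updateAt-delete {suc U} (suc u) w x≡y (suc v) = updateAt-delete u w (λ v → x≡y (suc v)) v

  -- States take values in ℕ and a deletion starts from a bumped state, so nonnegativity holds by
  -- construction and no truncated subtraction occurs. Every constructor bounds the state it starts
  -- from, and `stop` the last one, so each prefix is covered as `Admissible` demands.
  data Path {U} (n : ℕ) : Vector ℕ U → Stream U → Vector ℕ U → Set where
    stop   : ∀ {y}         → total y ≤ n → Path n y [] y
    insert : ∀ {y u w τ z} → total y ≤ n → Path n (bump y u w) τ z → Path n y ((u , + w) ∷ τ) z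
    delete : ∀ {y u w τ z} → total (bump y u w) ≤ n → Path n y τ z →
             Path n (bump y u w) ((u , ℤ.- + w) ∷ τ) z
    skip   : ∀ {y u τ z}   → total y ≤ n → Path n y τ z → Path n y ((u , 0ℤ) ∷ τ) z

  path-++ : ∀ {y₁ y₂ y₃ : Vector ℕ U} {σ τ} → Path n y₁ σ y₂ → Path n y₂ τ y₃ → Path n y₁ (σ ++ τ) y₃
  path-++ (stop _)     q = q
  path-++ (insert b p) q = insert b (path-++ p q)
  path-++ (delete b p) q = delete b (path-++ p q)
  path-++ (skip b p)   q = skip b (path-++ p q)

  private
    Counts : Stream U → Vector ℕ U → Set
    Counts ρ y = ∀ v → freq ρ v ≡ + y v

    freq-∷ʳ : ∀ (ρ : Stream U) u Δ v → freq (ρ ++ (u , Δ) ∷ []) v ≡ updateAt (freq ρ) u (ℤ._+ Δ) v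
    freq-∷ʳ ρ u Δ v = cong-app snoc v
      where
      snoc : freq (ρ ++ (u , Δ) ∷ []) ≡ updateAt (freq ρ) u (ℤ._+ Δ)
      snoc = foldl-∷ʳ _ _ (u , Δ) ρ

    counts-insert : ∀ ρ {y : Vector ℕ U} u w → Counts ρ y → Counts (ρ ++ (u , + w) ∷ []) (bump y u w)
    counts-insert ρ u w c v = trans (freq-∷ʳ ρ u _ v) (updateAt-insert c u w v)

    counts-delete : ∀ ρ {y : Vector ℕ U} u w → Counts ρ (bump y u w) → Counts (ρ ++ (u , ℤ.- + w) ∷ []) y
    counts-delete ρ u w c v = trans (freq-∷ʳ ρ u _ v) (updateAt-delete u w c v)

    counts-skip : ∀ ρ {y : Vector ℕ U} u → Counts ρ y → Counts (ρ ++ (u , 0ℤ) ∷ []) y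
    counts-skip ρ u c v =
      trans (freq-∷ʳ ρ u _ v) (trans (updateAt-id-local u (freq ρ) (ℤ.+-identityʳ _) v) (c v))

    -- `freq` is a left fold, hence the induction carries the updates already read in `ρ`.
    counts-path : ∀ {y z : Vector ℕ U} ρ {τ} → Counts ρ y → Path n y τ z → Counts (ρ ++ τ) z
    counts-path ρ c (stop _) = subst (λ σ → Counts σ _) (sym (++-identityʳ ρ)) c
    counts-path ρ c (insert {u = u} {w} {τ} _ p) =
      subst (λ σ → Counts σ _) (++-assoc ρ _ τ) (counts-path (ρ ++ (u , + w) ∷ []) (counts-insert ρ u w c) p)
    counts-path ρ c (delete {u = u} {w} {τ} _ p) =
      subst (λ σ → Counts σ _) (++-assoc ρ _ τ) (counts-path (ρ ++ (u , ℤ.- + w) ∷ []) (counts-delete ρ u w c) p)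
    counts-path ρ c (skip {u = u} {τ} _ p) =
      subst (λ σ → Counts σ _) (++-assoc ρ _ τ) (counts-path (ρ ++ (u , 0ℤ) ∷ []) (counts-skip ρ u c) p)

    path-prefix : ∀ {y z : Vector ℕ U} ρ′ {τ} → Path n y (ρ′ ++ τ) z → ∃ λ y′ → Path n y ρ′ y′ × total y′ ≤ n
    path-prefix [] (stop b)     = _ , stop b , b
    path-prefix [] (insert b _) = _ , stop b , b
    path-prefix [] (delete b _) = _ , stop b , b
    path-prefix [] (skip b _)   = _ , stop b , b
    path-prefix (_ ∷ ρ′) (insert b p) = let y′ , p′ , b′ = path-prefix ρ′ p in y′ , insert b p′ , b′
    path-prefix (_ ∷ ρ′) (delete b p) = let y′ , p′ , b′ = path-prefix ρ′ p in y′ , delete b p′ , b′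
    path-prefix (_ ∷ ρ′) (skip b p)   = let y′ , p′ , b′ = path-prefix ρ′ p in y′ , skip b p′ , b′

    norm-counts : ∀ {x : Vector ℤ U} {y} → (∀ v → x v ≡ + y v) → ‖ x ‖₁ ≡ total y
    norm-counts x≡y = Sum.sum-cong-≗ +-0-commutativeMonoid (λ v → cong ℤ.∣_∣ (x≡y v))

  path⇒freq : ∀ {z : Vector ℕ U} {σ} → Path n (λ _ → 0) σ z → ∀ v → freq σ v ≡ + z v
  path⇒freq = counts-path [] (λ _ → refl)

  path⇒norm : ∀ {z : Vector ℕ U} {σ} → Path n (λ _ → 0) σ z → ‖ freq σ ‖₁ ≡ total z
  path⇒norm p = norm-counts (path⇒freq p)

  path⇒admissible : ∀ {z : Vector ℕ U} {σ} → Path n (λ _ → 0) σ z → Admissible n σ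
  path⇒admissible p ρ τ refl with path-prefix ρ p
  ... | y , p′ , total≤n =
    (λ u → subst (0ℤ ℤ.≤_) (sym (path⇒freq p′ u)) (ℤ.+≤+ z≤n)) ,
    subst (_≤ _) (sym (path⇒norm p′)) total≤n

  private
    ∑ᶻ : Vector ℤ U → ℤ
    ∑ᶻ = Sum.sum ℤ.+-0-commutativeMonoid

    ∑ᶻ-zero : ∀ {f : Vector ℤ U} → (∀ v → f v ≡ 0ℤ) → ∑ᶻ f ≡ 0ℤ
    ∑ᶻ-zero {zero}  _   = refl
    ∑ᶻ-zero {suc U} f≡0 = cong₂ ℤ._+_ (f≡0 zero) (∑ᶻ-zero (λ v → f≡0 (suc v)))

    ∑ᶻ-nonneg : ∀ {f : Vector ℤ U} → (∀ v → 0ℤ ℤ.≤ f v) → 0ℤ ℤ.≤ ∑ᶻ f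
    ∑ᶻ-nonneg {zero}  _   = ℤ.≤-refl
    ∑ᶻ-nonneg {suc U} 0≤f = ℤ.+-mono-≤ (0≤f zero) (∑ᶻ-nonneg (λ v → 0≤f (suc v)))

    term≤∑ᶻ : ∀ {f : Vector ℤ U} → (∀ v → 0ℤ ℤ.≤ f v) → ∀ u → f u ℤ.≤ ∑ᶻ f
    term≤∑ᶻ {f = f} 0≤f zero    = subst (ℤ._≤ ∑ᶻ f) (ℤ.+-identityʳ _) (ℤ.+-monoʳ-≤ (f zero) (∑ᶻ-nonneg (λ v → 0≤f (suc v))))
    term≤∑ᶻ {f = f} 0≤f (suc u) = subst (ℤ._≤ ∑ᶻ f) (ℤ.+-identityˡ _) (ℤ.+-mono-≤ (0≤f zero) (term≤∑ᶻ (λ v → 0≤f (suc v)) u))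

  rank-zero : ∀ {x : Vector ℤ U} k → (∀ v → toℕ v < k → x v ≡ 0ℤ) → rank x k ≡ 0ℤ
  rank-zero {x = x} k x≡0 = ∑ᶻ-zero (λ v → summand v (toℕ v <? k))
    where
    summand : ∀ v (d : Dec (toℕ v < k)) → (if ⌊ d ⌋ then x v else 0ℤ) ≡ 0ℤ
    summand v (yes v<k) = x≡0 v v<k
    summand v (no _)    = refl

  freq≤rank : ∀ {x : Vector ℤ U} k → (∀ v → 0ℤ ℤ.≤ x v) → ∀ u → toℕ u < k → x u ℤ.≤ rank x k
  freq≤rank {x = x} k 0≤x u u<k =
    subst (ℤ._≤ _) (selected (toℕ u <? k)) (term≤∑ᶻ (λ v → nonneg v (toℕ v <? k)) u)
    where
    nonneg : ∀ v (d : Dec (toℕ v < k)) → 0ℤ ℤ.≤ (if ⌊ d ⌋ then x v else 0ℤ)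
    nonneg v (yes _) = 0≤x v
    nonneg v (no _)  = ℤ.≤-refl
    selected : (d : Dec (toℕ u < k)) → (if ⌊ d ⌋ then x u else 0ℤ) ≡ x u
    selected (yes _)  = refl
    selected (no u≮k) = contradiction u<k u≮k

-- The word x ∷ w is stored by one item in the block number `length w` of
-- suc κ consecutive items, and then by w.  The multiplicity of that item is
-- wt (length w).
module Encoding {U : ℕ} {{_ : ℕ.NonZero U}} (κ : ℕ) (wt : ℕ → ℕ) where

  open import Data.Integer.Base using (+_)
  open import Data.Nat.Base
  open import Data.Nat.Properties
  open StreamStates

  private
    k = suc κ
    Word = List (Fin k)

  -- Blocks are numbered by the letters still to come, so earlier letters lie in higher blocks. Once
  -- the letters of `w` are deleted, the item of `x` is the smallest one present, and all ranks
  -- below it are 0.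
  position : Word → Fin k → ℕ
  position w x = length w * k + toℕ x

  position-injective : ∀ w → Injective _≡_ _≡_ (position w)
  position-injective w eq = toℕ-injective (+-cancelˡ-≡ (length w * k) _ _ eq)

  -- The reduction modulo `U` only makes this total; by `toℕ-item` nothing wraps around when the
  -- blocks fit into `U`.
  item : Word → Fin k → Fin U
  item w x = position w x mod U

  position<block : ∀ w x → position w x < suc (length w) * k
  position<block w x = subst (position w x <_) (+-comm (length w * k) k) (+-monoʳ-< (length w * k) (toℕ<n x))

  toℕ-item : ∀ w x → suc (length w) * k ≤ U → toℕ (item w x) ≡ position w x
  toℕ-item w x fits = trans (toℕ-fromℕ< _) (m<n⇒m%n≡m (<-≤-trans (position<block w x) fits))

  insertions : Word → Stream U
  insertions []      = []
  insertions (x ∷ w) = (item w x , + wt (length w)) ∷ insertions w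

  -- Last in, first out: the deletions nest with the insertions like brackets, which gives
  -- `path-insert-delete` its recursion.
  deletions : Word → Stream U
  deletions []      = []
  deletions (x ∷ w) = deletions w ++ (item w x , ℤ.- + wt (length w)) ∷ []

  -- The idle updates make the number of updates independent of the word.
  padded : ℕ → Word → Stream U
  padded T w = deletions w ++ replicate (T ∸ length w) (0 mod U , 0ℤ)

  length-insertions : ∀ w → length (insertions w) ≡ length w
  length-insertions []      = refl
  length-insertions (x ∷ w) = cong suc (length-insertions w)

  length-padded : ∀ T w → length w ≤ T → length (padded T w) ≡ T
  length-padded T w w≤T = begin
    length (padded T w)                                              ≡⟨ length-++ (deletions w) ⟩
    length (deletions w) + length (replicate (T ∸ length w) _)
      ≡⟨ cong₂ _+_ (length-deletions w) (length-replicate (T ∸ length w)) ⟩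
    length w + (T ∸ length w)                                        ≡⟨ m+[n∸m]≡n w≤T ⟩
    T                                                                ∎
    where
    open ≡-Reasoning
    length-deletions : ∀ w → length (deletions w) ≡ length w
    length-deletions []      = refl
    length-deletions (x ∷ w) = trans (length-++ (deletions w)) (trans (+-comm _ 1) (cong suc (length-deletions w)))

  wtSum : ℕ → ℕ
  wtSum zero    = 0
  wtSum (suc j) = wt j + wtSum j

  private
    variable
      n : ℕ
      y : Vector ℕ U

    path-replicate-skip : ∀ u p → total y ≤ n → Path n y (replicate p (u , 0ℤ)) y
    path-replicate-skip u zero    b = stop b
    path-replicate-skip u (suc p) b = skip b (path-replicate-skip u p b)

    total-bump+ : ∀ (y : Vector ℕ U) u j → total (bump y u (wt j)) + wtSum j ≡ total y + wtSum (suc j)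
    total-bump+ y u j = trans (cong (_+ wtSum j) (total-bump y u (wt j))) (+-assoc (total y) (wt j) (wtSum j))

    path-insert-delete : ∀ w → total y + wtSum (length w) ≤ n → Path n y (insertions w ++ deletions w) y
    path-insert-delete []      b = stop (≤-trans (m≤m+n _ 0) b)
    path-insert-delete {y = y} (x ∷ w) b =
      insert (≤-trans (m≤m+n _ _) b)
             (subst (λ σ → Path _ (bump y (item w x) (wt (length w))) σ y) (++-assoc (insertions w) (deletions w) _)
                    (path-++ (path-insert-delete w b′)
                             (delete (≤-trans (m≤m+n _ _) b′) (stop (≤-trans (m≤m+n _ _) b)))))
      where
      b′ = ≤-trans (≤-reflexive (total-bump+ y (item w x) (length w))) b

  -- Every letter of `front` goes to a block above all blocks still to be filled, so the items below
  -- stay empty. After `x`, the word `w` is inserted and removed again; the state just after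
  -- inserting `x` is thus the final one.
  path-reveal : ∀ T front x w (y : Vector ℕ U) (let X = front ++ x ∷ w) →
    length X * k ≤ U → total y + wtSum (length X) ≤ n →
    (∀ v → toℕ v < length X * k → y v ≡ 0) →
    ∃ λ z → Path n y (insertions X ++ padded T w) z
          × total z + wtSum (length w) ≡ total y + wtSum (length X)
          × wt (length w) ≤ z (item w x)
          × (∀ v → toℕ v < position w x → z v ≡ 0)
  path-reveal T [] x w y fits b empty = z ,
    insert (≤-trans (m≤m+n _ _) b)
           (subst (λ σ → Path _ z σ z) (++-assoc (insertions w) (deletions w) _)
                  (path-++ (path-insert-delete w b′) (path-replicate-skip _ (T ∸ length w) (≤-trans (m≤m+n _ _) b′)))) ,
    total-bump+ y (item w x) (length w) ,
    subst (wt (length w) ≤_) (sym (updateAt-updates (item w x) y)) (m≤n+m _ _) ,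
    λ v v<p → trans (updateAt-minimal v (item w x) y (λ { refl → <-irrefl (toℕ-item w x fits) v<p }))
                    (empty v (<-trans v<p (position<block w x)))
    where
    z = bump y (item w x) (wt (length w))
    b′ = ≤-trans (≤-reflexive (total-bump+ y (item w x) (length w))) b
  path-reveal T (a ∷ front) x w y fits b empty
    with path-reveal T front x w y′ (≤-trans (m≤n+m _ k) fits) (≤-trans (≤-reflexive total-y′) b) empty′
    where
    X = front ++ x ∷ w
    y′ = bump y (item X a) (wt (length X))
    total-y′ = total-bump+ y (item X a) (length X)
    empty′ : ∀ v → toℕ v < length X * k → y′ v ≡ 0
    empty′ v v<X = trans
      (updateAt-minimal v (item X a) y (λ { refl → <⇒≱ v<X (subst (length X * k ≤_) (sym (toℕ-item X a fits)) (m≤m+n _ _)) }))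
      (empty v (<-≤-trans v<X (m≤n+m _ k)))
  ... | z , p , total-z , rest =
    z , insert (≤-trans (m≤m+n _ _) b) p ,
    trans total-z (total-bump+ y (item (front ++ x ∷ w) a) (length (front ++ x ∷ w))) , rest

-- Ordered arithmetic of the rationals and the embeddings of ℤ and ℕ.

module RationalArithmetic where

  open import Data.Integer.Base using (+_)
  open import Data.Rational.Base
  open import Data.Rational.Properties
  open RingSolver using (solve-∀)

  ring : ACR.AlmostCommutativeRing 0ℓ 0ℓ
  ring = ACR.fromCommutativeRing +-*-commutativeRing (λ x → dec⇒maybe (0ℚ ≟ x))

  private variable
    p q r s t : ℚ

  *-monoʳ-< : 0ℚ < r → p < q → r * p < r * q
  *-monoʳ-< {r} 0<r = *-monoʳ-<-pos r {{positive 0<r}}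

  *-monoˡ-< : 0ℚ < r → p < q → p * r < q * r
  *-monoˡ-< {r} 0<r = *-monoˡ-<-pos r {{positive 0<r}}

  *-monoʳ-≤ : 0ℚ ≤ r → p ≤ q → r * p ≤ r * q
  *-monoʳ-≤ {r} 0≤r = *-monoˡ-≤-nonNeg r {{nonNegative 0≤r}}

  *-monoˡ-≤ : 0ℚ ≤ r → p ≤ q → p * r ≤ q * r
  *-monoˡ-≤ {r} 0≤r = *-monoʳ-≤-nonNeg r {{nonNegative 0≤r}}

  *-mono-≤ : 0ℚ ≤ p → 0ℚ ≤ s → p ≤ q → r ≤ s → p * r ≤ q * s
  *-mono-≤ 0≤p 0≤s p≤q r≤s = ≤-trans (*-monoʳ-≤ 0≤p r≤s) (*-monoˡ-≤ 0≤s p≤q)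

  *-cancelˡ-< : 0ℚ ≤ r → r * p < r * q → p < q
  *-cancelˡ-< {r} 0≤r = *-cancelˡ-<-nonNeg r {{nonNegative 0≤r}}

  *-cancelˡ-≤ : 0ℚ < r → r * p ≤ r * q → p ≤ q
  *-cancelˡ-≤ {r} 0<r = *-cancelˡ-≤-pos r {{positive 0<r}}

  0<* : 0ℚ < p → 0ℚ < q → 0ℚ < p * q
  0<* {p} {q} 0<p 0<q = subst (_< p * q) (*-zeroʳ p) (*-monoʳ-< 0<p 0<q)

  0≤* : 0ℚ ≤ p → 0ℚ ≤ q → 0ℚ ≤ p * q
  0≤* {p} {q} 0≤p 0≤q = subst (_≤ p * q) (*-zeroʳ p) (*-monoʳ-≤ 0≤p 0≤q)

  0<*⇒0<ʳ : 0ℚ < p → 0ℚ < p * q → 0ℚ < q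
  0<*⇒0<ʳ {p} {q} 0<p 0<pq = *-cancelˡ-< (<⇒≤ 0<p) (subst (_< p * q) (sym (*-zeroʳ p)) 0<pq)

  0<*⇒0<ˡ : 0ℚ < q → 0ℚ < p * q → 0ℚ < p
  0<*⇒0<ˡ {q} {p} 0<q 0<pq = 0<*⇒0<ʳ 0<q (subst (0ℚ <_) (*-comm p q) 0<pq)

  p+q<r⇒p<r-q : ∀ p q r → p + q < r → p < r - q
  p+q<r⇒p<r-q p q r p+q<r = subst (_< r - q) (cancel p q) (+-monoˡ-< (- q) p+q<r)
    where
    cancel : ∀ p q → p + q - q ≡ p
    cancel = solve-∀ ring

  ιᶻ : ℤ → ℚ
  ιᶻ i = i / 1

  -- Opaque because unfolding it exposes the gcd computations of _/_.
  opaque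
    ι : ℕ → ℚ
    ι k = ιᶻ (+ k)

  private
    toℚᵘ-ιᶻ : ∀ i → toℚᵘ (ιᶻ i) ℚᵘ.≃ mkℚᵘ i 0
    toℚᵘ-ιᶻ i = toℚᵘ-fromℚᵘ (mkℚᵘ i 0)

  ιᶻ-mono-< : ∀ {i j} → i ℤ.< j → ιᶻ i < ιᶻ j
  ιᶻ-mono-< {i} {j} i<j = toℚᵘ-cancel-< (ℚᵘ.<-respˡ-≃ (ℚᵘ.≃-sym (toℚᵘ-ιᶻ i))
    (ℚᵘ.<-respʳ-≃ (ℚᵘ.≃-sym (toℚᵘ-ιᶻ j)) (ℚᵘ.*<* (ℤ.*-monoʳ-<-pos (+ 1) i<j))))

  ιᶻ-mono-≤ : ∀ {i j} → i ℤ.≤ j → ιᶻ i ≤ ιᶻ j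
  ιᶻ-mono-≤ {i} {j} i≤j = ≮⇒≥ (λ j<i → ℤ.<⇒≱ (cancel j<i) i≤j)
    where
    cancel : ιᶻ j < ιᶻ i → j ℤ.< i
    cancel lt with ℚᵘ.<-respˡ-≃ (toℚᵘ-ιᶻ j) (ℚᵘ.<-respʳ-≃ (toℚᵘ-ιᶻ i) (toℚᵘ-mono-< lt))
    ... | ℚᵘ.*<* lt′ = subst₂ ℤ._<_ (ℤ.*-identityʳ j) (ℤ.*-identityʳ i) lt′

  opaque
    unfolding ι

    ι-mono-< : ∀ {a b} → a ℕ.< b → ι a < ι b
    ι-mono-< a<b = ιᶻ-mono-< (ℤ.+<+ a<b)

    ι-mono-≤ : ∀ {a b} → a ℕ.≤ b → ι a ≤ ι b
    ι-mono-≤ a≤b = ιᶻ-mono-≤ (ℤ.+≤+ a≤b)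

  ι-cancel-≤ : ∀ {a b} → ι a ≤ ι b → a ℕ.≤ b
  ι-cancel-≤ {a} {b} le = ℕ.≮⇒≥ (λ b<a → <-irrefl refl (<-≤-trans (ι-mono-< {b} {a} b<a) le))

  opaque
    unfolding ι

    0≤ι : ∀ a → 0ℚ ≤ ι a
    0≤ι a = ι-mono-≤ {0} {a} ℕ.z≤n

    0<ι : ∀ {a} → 0 ℕ.< a → 0ℚ < ι a
    0<ι {a} = ι-mono-< {0} {a}

    ι-0 : ι 0 ≡ 0ℚ
    ι-0 = refl

    ι-1 : ι 1 ≡ 1ℚ
    ι-1 = refl

    ι-+ : ∀ a b → ι (a ℕ.+ b) ≡ ι a + ι b
    ι-+ a b = toℚᵘ-injective (begin
      toℚᵘ (ι (a ℕ.+ b))              ≈⟨ toℚᵘ-ιᶻ _ ⟩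
      mkℚᵘ (+ (a ℕ.+ b)) 0
        ≈⟨ ℚᵘ.*≡* (cong (ℤ._* + 1) (cong₂ ℤ._+_ (ℤ.*-identityʳ (+ a)) (ℤ.*-identityʳ (+ b)))) ⟨
      mkℚᵘ (+ a) 0 ℚᵘ.+ mkℚᵘ (+ b) 0  ≈⟨ ℚᵘ.+-cong (toℚᵘ-ιᶻ (+ a)) (toℚᵘ-ιᶻ (+ b)) ⟨
      toℚᵘ (ι a) ℚᵘ.+ toℚᵘ (ι b)      ≈⟨ toℚᵘ-homo-+ (ι a) (ι b) ⟨
      toℚᵘ (ι a + ι b)                ∎)
      where open ℚᵘ.≃-Reasoning

    ι-* : ∀ a b → ι (a ℕ.* b) ≡ ι a * ι b
    ι-* a b = toℚᵘ-injective (begin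
      toℚᵘ (ι (a ℕ.* b))              ≈⟨ toℚᵘ-ιᶻ _ ⟩
      mkℚᵘ (+ (a ℕ.* b)) 0            ≈⟨ ℚᵘ.*≡* (cong (ℤ._* + 1) (ℤ.pos-* a b)) ⟩
      mkℚᵘ (+ a) 0 ℚᵘ.* mkℚᵘ (+ b) 0  ≈⟨ ℚᵘ.*-cong (toℚᵘ-ιᶻ (+ a)) (toℚᵘ-ιᶻ (+ b)) ⟨
      toℚᵘ (ι a) ℚᵘ.* toℚᵘ (ι b)      ≈⟨ toℚᵘ-homo-* (ι a) (ι b) ⟨
      toℚᵘ (ι a * ι b)                ∎)
      where open ℚᵘ.≃-Reasoning

-- From inequalities between cuts to inequalities between numbers.

module CutBounds where

  open import Data.Integer.Base using (+_)
  open import Data.Rational.Base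
  open import Data.Rational.Properties
  open RationalArithmetic
  open RingSolver using (solve-∀)

  lower-downward : ∀ {x a b} → IsReal x → a ≤ b → lower x b → lower x a
  lower-downward {x} {a} {b} X a≤b xb with <-cmp a b
  ... | tri< a<b _ _  = Equivalence.from (IsReal.lower-rounded X a) (b , a<b , xb)
  ... | tri≈ _ refl _ = xb
  ... | tri> _ _ b<a  = contradiction (<-≤-trans b<a a≤b) (<-irrefl refl)

  lower<upper : ∀ {x a b} → IsReal x → lower x a → upper x b → a < b
  lower<upper {x} {a} {b} X xa xb = ≰⇒> (λ b≤a → IsReal.disjoint X b (lower-downward X b≤a xa) xb)

  opaque
    unfolding ι

    ⊖≤fromℤ : ∀ {q y R c} → fromℕ q ⊖ y ≤ᶜ fromℤ R → upper y c → ι q ≤ ιᶻ R + c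
    ⊖≤fromℤ {q} {y} {R} {c} le yc = ≮⇒≥ λ R+c<q →
      let t , R+c<t , t<q = <-dense R+c<q
          b , t<b , b<q   = <-dense t<q
      in le (t - c , p+q<r⇒p<r-q (ιᶻ R) c t R+c<t , b , c , b<q , yc , +-monoˡ-< (- c) t<b)

    fromℤ≤⊕ : ∀ {q y R c} → fromℤ R ≤ᶜ fromℕ q ⊕ y → upper y c → ιᶻ R ≤ ι q + c
    fromℤ≤⊕ {q} {y} {R} {c} le yc = ≮⇒≥ λ q+c<R →
      let t , q+c<t , t<R = <-dense q+c<R
          b , q<b , b<t-c = <-dense (p+q<r⇒p<r-q (ι q) c t q+c<t)
      in le (t , (b , c , q<b , yc , subst (b + c <_) (restore t c) (+-monoˡ-< c b<t-c)) , t<R)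
      where
      restore : ∀ t c → t - c + c ≡ t
      restore = solve-∀ ring

    -- The cut of `N` offers only rationals strictly on either side of it, so `1 + N` replaces `N`
    -- in the bound. The corner `b * ι (1 + N)` is the largest of the four products because
    -- `0 < e < b` and `N - 1 < 1 + N`.
    upper-⊗-fromℕ : ∀ {ε e b c} N → IsReal ε → 0ℚ < e → lower ε e → upper ε b →
                    b * ι (1 ℕ.+ N) < c → upper (ε ⊗ fromℕ N) c
    upper-⊗-fromℕ {ε} {e} {b} {c} N E 0<e εe εb bound =
      e , b , ι N - 1ℚ , ι (1 ℕ.+ N) , (εe , εb , N-1<N , N<1+N) ,
      <-trans (*-monoʳ-< 0<e N-1<1+N) e[1+N]<c , e[1+N]<c ,
      <-trans (*-monoʳ-< (<-trans 0<e e<b) N-1<1+N) bound , bound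
      where
      e<b : e < b
      e<b = lower<upper E εe εb
      N-1<N : ι N - 1ℚ < ι N
      N-1<N = subst (ι N - 1ℚ <_) (+-identityʳ (ι N)) (+-monoʳ-< (ι N) (negative⁻¹ (- 1ℚ)))
      N<1+N : ι N < ι (1 ℕ.+ N)
      N<1+N = ι-mono-< {N} (ℕ.n<1+n N)
      N-1<1+N : ι N - 1ℚ < ι (1 ℕ.+ N)
      N-1<1+N = <-trans N-1<N N<1+N
      e[1+N]<c : e * ι (1 ℕ.+ N) < c
      e[1+N]<c = <-trans (*-monoˡ-< (ι-mono-< {0} {1 ℕ.+ N} (ℕ.s≤s ℕ.z≤n)) e<b) bound

    -- If the conclusion failed, the interval from 9/10 to `b′` around 1 - δ and the one from `S⁻`
    -- to `1 + size` around `size` would have all four corner products above `len`, contradicting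
    -- the assumed inequality of cuts.
    PrAtLeast-1-δ⇒ : ∀ {δ a size len} → IsReal δ → upper δ a → a < + 1 / 10 →
      (fromℕ 1 ⊖ δ) ⊗ fromℕ size ≤ᶜ fromℕ len → 9 ℕ.* size ℕ.≤ 10 ℕ.* len
    PrAtLeast-1-δ⇒ {δ} {a} {size} {len} D δa a<⅒ le = ℕ.≮⇒≥ λ few →
      let d , δd = IsReal.lower-inhabited D
          b , 9/10+a<b , b<1 = <-dense {+ 9 / 10 + a} {1ℚ} (+-monoʳ-< (+ 9 / 10) a<⅒)
          9/10<b-a = p+q<r⇒p<r-q (+ 9 / 10) a b 9/10+a<b
          -- Interval multiplication also demands an upper end point for 1 - δ. Any will do; this
          -- one comes from an arbitrary `d` below δ.
          b′ = ι 3 - d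
          t , len<t , t<p = <-dense (product few)
          9/10<b′ : + 9 / 10 < b′
          9/10<b′ = p+q<r⇒p<r-q (+ 9 / 10) d (ι 3)
            (<-trans (+-monoʳ-< (+ 9 / 10) (<-trans (lower<upper D δd δa) a<⅒)) (from-yes (1ℚ <? ι 3)))
          0<S⁻ = 0<S few
          S⁻<S⁺ = <-trans S⁻<S (ι-mono-< {size} (ℕ.n<1+n size))
          p<  = *-monoʳ-< {+ 9 / 10} (positive⁻¹ (+ 9 / 10)) S⁻<S⁺
          p<′ = *-monoˡ-< 0<S⁻ 9/10<b′
      in le (t , len<t , + 9 / 10 , b′ , S⁻ , ι (1 ℕ.+ size) ,
        ((b , a , b<1 , δa , 9/10<b-a) ,
         (ι 2 , d , ι-mono-< {1} {2} (ℕ.n<1+n 1) , δd , +-monoˡ-< (- d) (ι-mono-< {2} {3} (ℕ.n<1+n 2))) ,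
         S⁻<S , ι-mono-< {size} (ℕ.n<1+n size)) ,
        t<p , <-trans t<p p< , <-trans t<p p<′ ,
        <-trans (<-trans t<p p<) (*-monoˡ-< (<-trans 0<S⁻ S⁻<S⁺) 9/10<b′))
      where
      S⁻ : ℚ
      -- The end point must be strictly below `size`. Integrality leaves 9 · size - 10 · len ≥ 1,
      -- and the shift costs only 10 · 9/10 · 1/20 = 9/20 of this gap.
      S⁻ = ι size - + 1 / 20
      S⁻<S : S⁻ < ι size
      S⁻<S = subst (S⁻ <_) (+-identityʳ (ι size)) (+-monoʳ-< (ι size) (negative⁻¹ (- (+ 1 / 20))))
      0<S : 10 ℕ.* len ℕ.< 9 ℕ.* size → 0ℚ < S⁻
      0<S few = p+q<r⇒p<r-q 0ℚ (+ 1 / 20) (ι size)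
        (<-≤-trans (from-yes (0ℚ + + 1 / 20 <? ι 1)) (ι-mono-≤ {1} {size} (nonempty size few)))
        where
        nonempty : ∀ size → 10 ℕ.* len ℕ.< 9 ℕ.* size → 1 ℕ.≤ size
        nonempty ℕ.zero    ()
        nonempty (ℕ.suc _) _ = ℕ.s≤s ℕ.z≤n
      product : 10 ℕ.* len ℕ.< 9 ℕ.* size → ι len < + 9 / 10 * S⁻
      product few = *-cancelˡ-< (0≤ι 10) (begin-strict
        ι 10 * ι len                        ≡⟨ ι-* 10 len ⟨
        ι (10 ℕ.* len)                      ≡⟨ cancel (ι (10 ℕ.* len)) ⟩
        1ℚ + ι (10 ℕ.* len) - 1ℚ            ≡⟨ cong (_- 1ℚ) (ι-+ 1 (10 ℕ.* len)) ⟨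
        ι (1 ℕ.+ 10 ℕ.* len) - 1ℚ
          ≤⟨ +-monoˡ-≤ (- 1ℚ) (ι-mono-≤ {1 ℕ.+ 10 ℕ.* len} {9 ℕ.* size} few) ⟩
        ι (9 ℕ.* size) - 1ℚ
          <⟨ +-monoʳ-< (ι (9 ℕ.* size)) (from-yes (- 1ℚ <? - (+ 9 / 20))) ⟩
        ι (9 ℕ.* size) - + 9 / 20           ≡⟨ cong (_- + 9 / 20) (ι-* 9 size) ⟩
        ι 9 * ι size - + 9 / 20             ≡⟨ expand (ι size) ⟩
        ι 10 * (+ 9 / 10 * S⁻)              ∎)
        where
        open ≤-Reasoning
        cancel : ∀ x → x ≡ 1ℚ + x - 1ℚ
        cancel = solve-∀ ring
        expand : ∀ s → ι 9 * s - + 9 / 20 ≡ ι 10 * (+ 9 / 10 * (s - + 1 / 20))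
        expand = solve-∀ ring

-- From a quantile algorithm to a strategy in the guessing game.

module Reduction where

  open import Data.Integer.Base using (+_)
  open import Data.Nat.Base
  open import Data.Nat.Properties
  open import Data.Nat.Tactic.RingSolver using (solve-∀)
  open FiniteSums
  open GuessingGame
  open StreamStates
  open RationalArithmetic using (ι; ιᶻ)
  open CutBounds

  bitStrings : ∀ S → List (Vec Bool S)
  bitStrings zero    = Vec.[] ∷ []
  bitStrings (suc S) = cartesianProductWith Vec._∷_ (true ∷ false ∷ []) (bitStrings S)

  length-bitStrings : ∀ S → length (bitStrings S) ≡ 2 ^ S
  length-bitStrings zero    = refl
  length-bitStrings (suc S) = trans (length-cartesianProductWith Vec._∷_ (true ∷ false ∷ []) (bitStrings S))
                                    (cong (2 *_) (length-bitStrings S))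

  ∈-bitStrings : ∀ {S} (m : Vec Bool S) → m ∈ bitStrings S
  ∈-bitStrings Vec.[]            = here refl
  ∈-bitStrings (true  Vec.∷ m) = ∈-cartesianProductWith⁺ Vec._∷_ {xs = true ∷ false ∷ []} (here refl) (∈-bitStrings m)
  ∈-bitStrings (false Vec.∷ m) = ∈-cartesianProductWith⁺ Vec._∷_ {xs = true ∷ false ∷ []} (there (here refl)) (∈-bitStrings m)

  opaque
    unfolding ι

    -- The rank jumps from 0 to at least `2q` at `p`, and the query aims at the middle of the jump,
    -- so an error below `q` cannot move the answer away from `p`. An answer left of `p` violates
    -- the lower rank condition, one right of `p` the upper.
    correct⇒position : ∀ {U} {ε : Cut} {x : Vector ℤ U} {q p c u} →
      Correct ε x q u → upper (ε ⊗ fromℕ ‖ x ‖₁) c → c ℚ.< ι q →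
      (∀ j → j ≤ p → rank x j ≡ 0ℤ) → (∀ j → p < j → + (q + q) ℤ.≤ rank x j) → toℕ u ≡ p
    correct⇒position {ε = ε} {x} {q} {p} {c} {u} (above , below) upper-c c<q rank≡0 2q≤rank =
      ≤-antisym (≮⇒≥ p≮u) (s≤s⁻¹ (≰⇒> u≮p))
      where
      open ℚ.≤-Reasoning
      u≮p : ¬ suc (toℕ u) ≤ p
      u≮p u<p = ℚ.<-irrefl refl (begin-strict
        ι q
          ≤⟨ ⊖≤fromℤ {q} {ε ⊗ fromℕ ‖ x ‖₁} {rank x (suc (toℕ u))} above upper-c ⟩
        ιᶻ (rank x (suc (toℕ u))) ℚ.+ c     ≡⟨ cong (λ r → ιᶻ r ℚ.+ c) (rank≡0 _ u<p) ⟩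
        0ℚ ℚ.+ c                            ≡⟨ ℚ.+-identityˡ c ⟩
        c                                   <⟨ c<q ⟩
        ι q                                 ∎)
      p≮u : ¬ p < toℕ u
      p≮u p<u = ℚ.<-irrefl refl (begin-strict
        ι q ℚ.+ c                ≡⟨ ℚ.+-comm (ι q) c ⟩
        c ℚ.+ ι q                <⟨ ℚ.+-monoˡ-< (ι q) c<q ⟩
        ι q ℚ.+ ι q              ≡⟨ RationalArithmetic.ι-+ q q ⟨
        ι (q + q)                ≤⟨ RationalArithmetic.ιᶻ-mono-≤ (2q≤rank _ p<u) ⟩
        ιᶻ (rank x (toℕ u))      ≤⟨ fromℤ≤⊕ {q} {ε ⊗ fromℕ ‖ x ‖₁} {rank x (toℕ u)} below upper-c ⟩
        ι q ℚ.+ c                ∎)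

  module Simulation {U S : ℕ} (A : Algorithm U S) where

    open Algorithm A

    -- The type `Outcome σ` depends on the stream. Plain coin lists give all streams of one length a
    -- common sample space, in which a single outcome serves for every suffix of the word.
    runList : Seed → Stream U → List Coin → Memory → Memory
    runList s []      cs       m = m
    -- Default for missing coins, chosen so that `runList-++` holds for coin lists of any length.
    runList s (e ∷ σ) []       m = m
    runList s (e ∷ σ) (c ∷ cs) m = runList s σ cs (step s c e m)

    run≡runList : ∀ s σ cs m → run s σ cs m ≡ runList s σ (Vec.toList cs) m
    run≡runList s []      Vec.[]         m = refl
    run≡runList s (e ∷ σ) (c Vec.∷ cs) m = run≡runList s σ cs (step s c e m)

    runList-++ : ∀ s σ τ cs m → runList s (σ ++ τ) cs m ≡ runList s τ (drop (length σ) cs) (runList s σ cs m)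
    runList-++ s []      τ       cs       m = refl
    runList-++ s (e ∷ σ) []      []       m = refl
    runList-++ s (e ∷ σ) (_ ∷ _) []       m = refl
    runList-++ s (e ∷ σ) τ       (c ∷ cs) m = runList-++ s σ τ cs (step s c e m)

    Randomness : Set
    Randomness = Seed × List Coin × Coin

    randomness : ℕ → List Randomness
    randomness N = cartesianProductWith _,_ (allFin seeds)
      (cartesianProductWith _,_ (words (allFin coins) N) (allFin coins))

    length-randomness : ∀ N → length (randomness N) ≡ seeds * (coins ^ N * coins)
    length-randomness N = begin
      length (randomness N)
        ≡⟨ length-cartesianProductWith _,_ (allFin seeds) _ ⟩
      length (allFin seeds) * length (cartesianProductWith _,_ (words (allFin coins) N) (allFin coins))
        ≡⟨ cong₂ _*_ (length-allFin seeds) (length-cartesianProductWith _,_ (words (allFin coins) N) (allFin coins)) ⟩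
      seeds * (length (words (allFin coins) N) * length (allFin coins))
        ≡⟨ cong (seeds *_) (cong₂ _*_
             (trans (length-words (allFin coins) N) (cong (_^ N) (length-allFin coins))) (length-allFin coins)) ⟩
      seeds * (coins ^ N * coins) ∎
      where
      open ≡-Reasoning
      length-allFin : ∀ n → length (allFin n) ≡ n
      length-allFin n = length-tabulate (λ i → i)

    flatten : ∀ σ → Outcome σ → Randomness
    flatten σ (s , cs , c) = s , Vec.toList cs , c

    flatten-injective : ∀ σ → Injective _≡_ _≡_ (flatten σ)
    flatten-injective σ {s , cs , c} {s′ , cs′ , c′} eq =
      cong₂ _,_ (cong proj₁ eq)
        (cong₂ _,_ (trans (sym (cast-is-id refl cs)) (toList-injective refl cs cs′ (cong (λ z → proj₁ (proj₂ z)) eq)))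
                   (cong (λ z → proj₂ (proj₂ z)) eq))

    flatten∈randomness : ∀ σ (ω : Outcome σ) → flatten σ ω ∈ randomness (length σ)
    flatten∈randomness σ (s , cs , c) = ∈-cartesianProductWith⁺ _,_ (∈-allFin s)
      (∈-cartesianProductWith⁺ _,_
        (subst (λ N → Vec.toList cs ∈ words (allFin coins) N) (length-toList cs) (∈-words⁺ ∈-allFin (Vec.toList cs)))
        (∈-allFin c))

    outputList : Stream U → ℕ → Randomness → Fin U
    outputList σ q (s , cs , c) = answer s c q (runList s σ cs (initial s))

    -- `flatten` maps outcomes injectively into a list of exactly `#outcomes σ` entries, so the
    -- proportion of 9/10 survives the change of sample space. Correctness is then weakened to the
    -- decidable event that the answer is `p`.
    solves⇒often : ∀ {ε δ a n} → IsReal δ → upper δ a → a ℚ.< + 1 ℚ./ 10 → SolvesAQ ε δ n U A →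
      ∀ σ q p → Admissible n σ → 1 ≤ q → q ≤ ‖ freq σ ‖₁ →
      (∀ u → Correct ε (freq σ) q u → toℕ u ≡ p) →
      9 * length (randomness (length σ)) ≤ 10 * ∑ (randomness (length σ)) (λ ω → 𝟙 (toℕ (outputList σ q ω) ≟ p))
    solves⇒often {ε} {δ} D δa a<⅒ solves σ q p admissible 1≤q q≤N correct⇒p
      = conclude (solves σ admissible q 1≤q q≤N)
      where
      inside : ∀ {ωs ω} → ω ∈ List.map (flatten σ) ωs → ω ∈ randomness (length σ)
      inside ω∈ = let ω′ , _ , ω≡ = ∈-map⁻ (flatten σ) ω∈ in
        subst (_∈ randomness (length σ)) (sym ω≡) (flatten∈randomness σ ω′)
      conclude : PrAtLeast (Outcome σ) (#outcomes σ) (λ ω → Correct ε (freq σ) q (output σ q ω)) (fromℕ 1 ⊖ δ) →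
        9 * length (randomness (length σ)) ≤ 10 * ∑ (randomness (length σ)) (λ ω → 𝟙 (toℕ (outputList σ q ω) ≟ p))
      conclude (ωs , unique , correct , probable) = begin
        9 * length (randomness (length σ))      ≡⟨ cong (9 *_) (length-randomness (length σ)) ⟩
        9 * #outcomes σ
          ≤⟨ PrAtLeast-1-δ⇒ {δ} {size = #outcomes σ} {length ωs} D δa a<⅒ probable ⟩
        10 * length ωs                          ≡⟨ cong (10 *_) (length-map (flatten σ) ωs) ⟨
        10 * length (List.map (flatten σ) ωs)
          ≤⟨ *-monoʳ-≤ 10 (unique⇒length≤∑ (λ ω → toℕ (outputList σ q ω) ≟ p)
                                                      (Unique.map⁺ (flatten-injective σ) unique) outputs inside) ⟩
        10 * ∑ (randomness (length σ)) (λ ω → 𝟙 (toℕ (outputList σ q ω) ≟ p))  ∎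
        where
        open ≤-Reasoning
        outputs : All (λ ω → toℕ (outputList σ q ω) ≡ p) (List.map (flatten σ) ωs)
        outputs = All.map⁺ (All.map (λ { {s , cs , c} ok →
          trans (cong (λ m → toℕ (answer s c q m)) (sym (run≡runList s σ cs (initial s)))) (correct⇒p _ ok) }) correct)

  private
    -- Origin of the 8 in the condition `fine`: a total of `2 * (V + v)`, plus the unit lost in
    -- `upper-⊗-fromℕ`, stays below `8 * M` times the query.
    2+2[V+v]≤8Mv : ∀ M V v .{{_ : NonZero M}} → V < (M + M) * v → 2 + 2 * (V + v) ≤ 8 * M * v
    2+2[V+v]≤8Mv M V v V<2Mv = begin
      2 + 2 * (V + v)                 ≡⟨ regroup₁ V v ⟩
      2 * suc V + 2 * v               ≤⟨ +-mono-≤ (*-monoʳ-≤ 2 V<2Mv) (*-monoʳ-≤ 2 (m≤n*m v M)) ⟩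
      2 * ((M + M) * v) + 2 * (M * v) ≤⟨ m≤m+n _ (2 * (M * v)) ⟩
      2 * ((M + M) * v) + 2 * (M * v) + 2 * (M * v)  ≡⟨ regroup₂ M v ⟩
      8 * M * v                       ∎
      where
      open ≤-Reasoning
      regroup₁ : ∀ V v → 2 + 2 * (V + v) ≡ 2 * suc V + 2 * v
      regroup₁ = solve-∀
      regroup₂ : ∀ M v → 2 * ((M + M) * v) + 2 * (M * v) + 2 * (M * v) ≡ 8 * M * v
      regroup₂ = solve-∀

    total-0 : ∀ {U} → total {U} (λ _ → 0) ≡ 0
    total-0 {zero}  = refl
    total-0 {suc U} = total-0 {U}

  module _ {U S : ℕ} {{_ : NonZero U}} (A : Algorithm U S) {ε δ : Cut} {e b a : ℚ} {n : ℕ}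
           (E : IsReal ε) (0<e : 0ℚ ℚ.< e) (εe : lower ε e) (εb : upper ε b)
           (D : IsReal δ) (δa : upper δ a) (a<⅒ : a ℚ.< + 1 ℚ./ 10)
           (solves : SolvesAQ ε δ n U A) where

    open Simulation A
    open Algorithm A

    module _ (κ M L : ℕ) {{_ : NonZero M}} {{_ : NonZero (M + M)}}
             (fine : b ℚ.* ι (8 * M) ℚ.≤ 1ℚ)
             (4M2ᴸ≤n : 4 * (M * 2 ^ L) ≤ n)
             (fits : L * M * suc κ ≤ U) where

      open Weights (M + M)

      private
        k = suc κ
        T = L * M
        -- The index `j` counts the letters still to come, so the weights are read backwards in `j`,
        -- hence forwards along the stream.
        query : ℕ → ℕ
        query j = weight (T ∸ suc j)
        -- Twice the query, which puts the query in the middle of the rank jump at the item.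
        wt : ℕ → ℕ
        wt j = query j + query j

      open Encoding {U} κ wt

      private
        -- `wtSum j` is the mass of the last `j` letters, so this identifies the mass that survives
        -- their deletion.
        wtSum≡ : ∀ j → j ≤ T → 2 * weightSum (T ∸ j) + wtSum j ≡ 2 * weightSum T
        wtSum≡ zero    _   = +-identityʳ _
        wtSum≡ (suc j) j<T = begin
          2 * V + (wt j + wtSum j)                    ≡⟨ regroup V (query j) (wtSum j) ⟩
          2 * weightSum (suc (T ∸ suc j)) + wtSum j
            ≡⟨ cong (λ i → 2 * weightSum i + wtSum j) (+-∸-assoc 1 j<T) ⟨
          2 * weightSum (T ∸ j) + wtSum j             ≡⟨ wtSum≡ j (<⇒≤ j<T) ⟩
          2 * weightSum T                             ∎
          where
          open ≡-Reasoning
          V = weightSum (T ∸ suc j)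
          regroup : ∀ V q s → 2 * V + (q + q + s) ≡ 2 * (V + q) + s
          regroup = solve-∀

        wtSum-T≡ : wtSum T ≡ 2 * weightSum T
        wtSum-T≡ = trans (cong (λ i → 2 * weightSum i + wtSum T) (sym (n∸n≡0 T))) (wtSum≡ T ≤-refl)

        wtSum≤n : wtSum T ≤ n
        wtSum≤n = begin
          wtSum T                         ≡⟨ wtSum-T≡ ⟩
          2 * weightSum T
            ≤⟨ *-monoʳ-≤ 2 (≤-trans (m≤m+n (weightSum T) (M + M)) (weightSum-doubling M refl L)) ⟩
          2 * (2 ^ L * (M + M))           ≡⟨ regroup (2 ^ L) M ⟩
          4 * (M * 2 ^ L)                 ≤⟨ 4M2ᴸ≤n ⟩
          n                               ∎
          where
          open ≤-Reasoning
          regroup : ∀ p M → 2 * (p * (M + M)) ≡ 4 * (M * p)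
          regroup = solve-∀

        error<query : ∀ i N → N ≡ 2 * weightSum (suc i) → b ℚ.* ι (1 + N) ℚ.< ι (weight i)
        error<query i N refl = begin-strict
          b ℚ.* ι (1 + N)
            <⟨ RationalArithmetic.*-monoʳ-< 0<b (RationalArithmetic.ι-mono-< {1 + N} {8 * M * v} 1+N<8Mv) ⟩
          b ℚ.* ι (8 * M * v)             ≡⟨ cong (b ℚ.*_) (RationalArithmetic.ι-* (8 * M) v) ⟩
          b ℚ.* (ι (8 * M) ℚ.* ι v)       ≡⟨ ℚ.*-assoc b (ι (8 * M)) (ι v) ⟨
          b ℚ.* ι (8 * M) ℚ.* ι v         ≤⟨ RationalArithmetic.*-monoˡ-≤ (RationalArithmetic.0≤ι v) fine ⟩
          1ℚ ℚ.* ι v                      ≡⟨ ℚ.*-identityˡ (ι v) ⟩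
          ι v                             ∎
          where
          open ℚ.≤-Reasoning
          v = weight i
          0<b : 0ℚ ℚ.< b
          0<b = ℚ.<-trans 0<e (lower<upper E εe εb)
          1+N<8Mv : 1 + 2 * (weightSum i + v) < 8 * M * v
          1+N<8Mv = 2+2[V+v]≤8Mv M (weightSum i) v (weightSum<m*weight i)

        stream : List (Fin k) → List (Fin k) → Stream U
        stream X w = insertions X ++ padded T w

        length-stream : ∀ X w → length X ≡ T → length w ≤ T → length (stream X w) ≡ T + T
        length-stream X w X≡T w≤T = trans (length-++ (insertions X))
          (cong₂ _+_ (trans (length-insertions X) X≡T) (length-padded T w w≤T))

        reveal-often : ∀ front x w (let X = front ++ x ∷ w) → length X ≡ T →
          9 * length (randomness (T + T)) ≤
          10 * ∑ (randomness (T + T)) (λ ω → 𝟙 (toℕ (outputList (stream X w) (query (length w)) ω) ≟ position w x))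
        reveal-often front x w X≡T
          with path-reveal {n = n} T front x w (λ _ → 0)
                 (subst (λ t → t * k ≤ U) (sym X≡T) fits)
                 (≤-trans (≤-reflexive (cong₂ _+_ (total-0 {U}) (cong wtSum X≡T))) wtSum≤n)
                 (λ _ _ → refl)
        ... | z , path , total-z , wt≤z , z-empty =
          subst (λ N → 9 * length (randomness N) ≤
                       10 * ∑ (randomness N) (λ ω → 𝟙 (toℕ (outputList σ q ω) ≟ p)))
                (length-stream X w X≡T (<⇒≤ j<T))
                (solves⇒often {ε} D δa a<⅒ solves σ q p (path⇒admissible path) (s≤s z≤n) q≤N located)
          where
          X = front ++ x ∷ w
          σ = stream X w
          j = length w
          q = query j
          p = position w x
          j<T : j < T
          j<T = subst (suc j ≤_) (trans (sym (length-++ front)) X≡T) (m≤n+m (suc j) (length front))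
          N≡ : ‖ freq σ ‖₁ ≡ 2 * weightSum (suc (T ∸ suc j))
          N≡ = begin
            ‖ freq σ ‖₁                        ≡⟨ path⇒norm path ⟩
            total z                            ≡⟨ +-cancelʳ-≡ (wtSum j) _ _ (begin
              total z + wtSum j                ≡⟨ total-z ⟩
              total {U} (λ _ → 0) + wtSum (length X)
                ≡⟨ cong₂ _+_ (total-0 {U}) (trans (cong wtSum X≡T) wtSum-T≡) ⟩
              2 * weightSum T                  ≡⟨ wtSum≡ j (<⇒≤ j<T) ⟨
              2 * weightSum (T ∸ j) + wtSum j  ∎) ⟩
            2 * weightSum (T ∸ j)              ≡⟨ cong (λ i → 2 * weightSum i) (+-∸-assoc 1 j<T) ⟩
            2 * weightSum (suc (T ∸ suc j))    ∎
            where open ≡-Reasoning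
          q≤N : q ≤ ‖ freq σ ‖₁
          q≤N = subst (q ≤_) (sym N≡) (≤-trans (m≤n+m q (weightSum (T ∸ suc j))) (m≤m+n _ _))
          u₀ = item w x
          u₀≡p : toℕ u₀ ≡ p
          u₀≡p = toℕ-item w x (≤-trans (*-monoˡ-≤ k j<T) fits)
          nonneg : ∀ v → 0ℤ ℤ.≤ freq σ v
          nonneg v = subst (0ℤ ℤ.≤_) (sym (path⇒freq path v)) (ℤ.+≤+ z≤n)
          located : ∀ u → Correct ε (freq σ) q u → toℕ u ≡ p
          located u ok = let c , error<c , c<q = ℚ.<-dense (error<query (T ∸ suc j) ‖ freq σ ‖₁ N≡) in
            correct⇒position {ε = ε} {x = freq σ} {q} {p} {c} {u} ok (upper-⊗-fromℕ ‖ freq σ ‖₁ E 0<e εe εb error<c) c<q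
              (λ i i≤p → rank-zero i (λ v v<i → trans (path⇒freq path v) (cong +_ (z-empty v (<-≤-trans v<i i≤p)))))
              (λ i p<i → ℤ.≤-trans (subst (+ (q + q) ℤ.≤_) (sym (path⇒freq path u₀)) (ℤ.+≤+ wt≤z))
                                   (freq≤rank i nonneg u₀ (subst (_< i) (sym u₀≡p) p<i)))

        Ω = randomness (T + T)

        encode : Randomness → List (Fin k) → Memory
        encode (s , cs , c) X = runList s (insertions X) cs (initial s)

        -- The insertions have used the first `T` coins. Dropping these makes the decoder continue
        -- the very run that produced the message.
        guess : Randomness → Memory → List (Fin k) → ℕ
        guess (s , cs , c) m w = toℕ (answer s c (query (length w)) (runList s (padded T w) (drop T cs) m))

        goodGuesses = hits position position-injective

        guess≡output : ∀ X w → length X ≡ T → ∀ ω →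
          toℕ (outputList (stream X w) (query (length w)) ω) ≡ guess ω (encode ω X) w
        guess≡output X w X≡T (s , cs , c) = cong (λ m → toℕ (answer s c (query (length w)) m))
          (trans (runList-++ s (insertions X) (padded T w) cs (initial s))
                 (cong (λ t → runList s (padded T w) (drop t cs) (encode (s , cs , c) X))
                       (trans (length-insertions X) X≡T)))

        -- Linearity of expectation over the positions. The message always encodes the whole word
        -- `X` while the recursion descends through its suffixes; `front` records what has been
        -- passed.
        hits-often : ∀ front w (let X = front ++ w) → length X ≡ T →
          9 * length w * length Ω ≤ 10 * ∑ Ω (λ ω → goodGuesses (guess ω (encode ω X)) w)
        hits-often front []      X≡T = z≤n
        hits-often front (x ∷ w) X≡T = begin
          9 * suc (length w) * length Ω
            ≡⟨ split (length w) (length Ω) ⟩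
          9 * length Ω + 9 * length w * length Ω
            ≤⟨ +-mono-≤ (≤-trans (reveal-often front x w X≡T)
                           (≤-reflexive (cong (10 *_) (∑-cong Ω
                             (λ ω → cong (λ y → 𝟙 (y ≟ position w x)) (guess≡output X w X≡T ω))))))
                        (subst (λ Y → 9 * length w * length Ω ≤ 10 * ∑ Ω (λ ω → goodGuesses (guess ω (encode ω Y)) w))
                               (++-assoc front (x ∷ []) w)
                               (hits-often (front ++ x ∷ []) w (trans (cong length (++-assoc front (x ∷ []) w)) X≡T))) ⟩
          10 * ∑ Ω (λ ω → 𝟙 (guess ω (encode ω X) w ≟ position w x)) +
          10 * ∑ Ω (λ ω → goodGuesses (guess ω (encode ω X)) w)
            ≡⟨ *-distribˡ-+ 10 (∑ Ω (λ ω → 𝟙 (guess ω (encode ω X) w ≟ position w x))) _ ⟨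
          10 * (∑ Ω (λ ω → 𝟙 (guess ω (encode ω X) w ≟ position w x)) +
                ∑ Ω (λ ω → goodGuesses (guess ω (encode ω X)) w))
            ≡⟨ cong (10 *_) (∑-+ Ω (λ ω → 𝟙 (guess ω (encode ω X) w ≟ position w x)) _) ⟨
          10 * ∑ Ω (λ ω → goodGuesses (guess ω (encode ω X)) (x ∷ w)) ∎
          where
          open ≤-Reasoning
          X = front ++ x ∷ w
          split : ∀ j l → 9 * suc j * l ≡ 9 * l + 9 * j * l
          split = solve-∀

      memory-bound : ∀ G ρ → 9 * T ≡ 10 * G + ρ →
        k ^ G * k ^ T * (10 + κ * ρ) ≤ 10 * (2 ^ S * (k + κ) ^ T)
      memory-bound G ρ 9T≡ = subst (λ l → k ^ G * k ^ T * (10 + κ * ρ) ≤ 10 * (l * (k + κ) ^ T)) (length-bitStrings S)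
        (message-bound position position-injective Ω (bitStrings S) ∈-bitStrings encode guess T G ρ 9T≡ {{nonempty}}
          (λ X X≡T → subst (λ t → 9 * t * length Ω ≤ 10 * ∑ Ω (λ ω → goodGuesses (guess ω (encode ω X)) X)) X≡T
                           (hits-often [] X X≡T)))
        where
        nonempty : NonZero (length Ω)
        nonempty = subst NonZero (sym (length-randomness (T + T)))
          (m*n≢0 seeds (coins ^ (T + T) * coins) {{seeds≢0}} {{m*n≢0 (coins ^ (T + T)) coins {{m^n≢0 coins (T + T)}}}})

-- Binary logarithms compared through integer powers.

module Logarithms where

  open import Data.Integer.Base using (+_; -[1+_])
  open import Data.Rational.Base
  open import Data.Rational.Properties
  open Defs using (_^_; 2^_)
  open RationalArithmetic
  open RingSolver using (solve-∀)

  private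
    module ^ = Exp (Algebra.Bundles.CommutativeRing.semiring +-*-commutativeRing)

  inverse : ∀ {b} → 0ℚ < b → ∃ λ y → 0ℚ < y × y * b ≡ 1ℚ
  inverse {b} 0<b = 1/ b , positive⁻¹ (1/ b) {{1/pos⇒pos b}} , *-inverseˡ b
    where instance
      b-pos : Positive b
      b-pos = positive 0<b
      b≢0 : NonZero b
      b≢0 = pos⇒nonZero b

  opaque
    unfolding ι

    *-denominator : ∀ a → a * ι (↧ₙ a) ≡ ιᶻ (↥ a)
    *-denominator a@(mkℚ _ d-1 _) = toℚᵘ-injective (begin
      toℚᵘ (a * ι (↧ₙ a))                 ≈⟨ toℚᵘ-homo-* a (ι (↧ₙ a)) ⟩
      toℚᵘ a ℚᵘ.* toℚᵘ (ι (↧ₙ a))         ≈⟨ ℚᵘ.*-congˡ {toℚᵘ a} (toℚᵘ-fromℚᵘ (mkℚᵘ (↧ a) 0)) ⟩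
      toℚᵘ a ℚᵘ.* mkℚᵘ (↧ a) 0
        ≈⟨ ℚᵘ.*≡* (trans (ℤ.*-identityʳ _) (cong (ℤ._*_ (↥ a)) (sym (ℤ.*-identityʳ (↧ a))))) ⟩
      mkℚᵘ (↥ a) 0                        ≈⟨ toℚᵘ-fromℚᵘ (mkℚᵘ (↥ a) 0) ⟨
      toℚᵘ (ιᶻ (↥ a))                     ∎)
      where open ℚᵘ.≃-Reasoning

  0≤↥ : ∀ {a} → 0ℚ ≤ a → ∃ λ p → ↥ a ≡ + p
  0≤↥ {mkℚ (+ p) _ _}      _   = p , refl
  0≤↥ {mkℚ -[1+ p ] _ _} 0≤a = contradiction (nonNegative 0≤a) λ ()

  0≤^ : ∀ {x} n → 0ℚ ≤ x → 0ℚ ≤ x ^ n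
  0≤^ ℕ.zero    _   = from-yes (0ℚ ≤? 1ℚ)
  0≤^ (ℕ.suc n) 0≤x = 0≤* 0≤x (0≤^ n 0≤x)

  ^-mono-≤ : ∀ {x y} n → 0ℚ ≤ x → x ≤ y → x ^ n ≤ y ^ n
  ^-mono-≤ ℕ.zero    _   _   = ≤-refl
  ^-mono-≤ (ℕ.suc n) 0≤x x≤y = *-mono-≤ 0≤x (≤-trans (0≤^ n 0≤x) (^-mono-≤ n 0≤x x≤y)) x≤y (^-mono-≤ n 0≤x x≤y)

  ^-mono-< : ∀ {x y} n .{{_ : ℕ.NonZero n}} → 0ℚ ≤ x → x < y → x ^ n < y ^ n
  ^-mono-< {x} {y} (ℕ.suc n) 0≤x x<y = ≤-<-trans (*-monoʳ-≤ 0≤x (^-mono-≤ n 0≤x (<⇒≤ x<y)))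
                                                 (*-monoˡ-< (0<^ n) x<y)
    where
    0<^ : ∀ n → 0ℚ < y ^ n
    0<^ ℕ.zero    = positive⁻¹ 1ℚ
    0<^ (ℕ.suc n) = 0<* (≤-<-trans 0≤x x<y) (0<^ n)

  ^-* : ∀ x m n → (x ^ m) ^ n ≡ x ^ (m ℕ.* n)
  ^-* = ^.^-assocʳ

  opaque
    unfolding ι

    ι-2^ : ∀ k → ι (2 ℕ.^ k) ≡ (+ 2 / 1) ^ k
    ι-2^ ℕ.zero    = refl
    ι-2^ (ℕ.suc k) = trans (ι-* 2 (2 ℕ.^ k)) (cong (+ 2 / 1 *_) (ι-2^ k))

  ι-2^-* : ∀ m n → ι (2 ℕ.^ (m ℕ.* n)) ≡ ι (2 ℕ.^ m) ^ n
  ι-2^-* m n = trans (ι-2^ (m ℕ.* n)) (trans (sym (^-* (+ 2 / 1) m n)) (cong (_^ n) (sym (ι-2^ m))))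

  ι-2^-mono : ∀ {m n} → m ℕ.≤ n → ι (2 ℕ.^ m) ≤ ι (2 ℕ.^ n)
  ι-2^-mono {m} {n} m≤n = ι-mono-≤ {2 ℕ.^ m} {2 ℕ.^ n} (ℕ.^-monoʳ-≤ 2 m≤n)

  private
    opaque
      unfolding ι
      ιᶻ-+ : ∀ p → ιᶻ (+ p) ≡ ι p
      ιᶻ-+ p = refl

    numerator : ∀ {a} → 0ℚ < a → ∃ λ p → a * ι (↧ₙ a) ≡ ι p × 2^ (↥ a) ≡ ι (2 ℕ.^ p)
    numerator {a} 0<a with 0≤↥ {a} (<⇒≤ 0<a)
    ... | p , ↥a≡p = p , trans (*-denominator a) (trans (cong ιᶻ ↥a≡p) (ιᶻ-+ p)) , trans (cong 2^_ ↥a≡p) (sym (ι-2^ p))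

    0<ι↧ : ∀ a → 0ℚ < ι (↧ₙ a)
    0<ι↧ (mkℚ _ d-1 _) = 0<ι (ℕ.s≤s ℕ.z≤n)

    ↧≢0 : ∀ a → ℕ.NonZero (↧ₙ a)
    ↧≢0 (mkℚ _ _ _) = _

  log-upper : ∀ {a x} β → 0ℚ < a → 0ℚ ≤ x → 2^ (↥ a) < x ^ (↧ₙ a) → x ≤ ι (2 ℕ.^ β) → a < ι β
  log-upper {a} {x} β 0<a 0≤x 2^p<x^d x≤2^β = ≰⇒> λ β≤a → <-irrefl refl (begin-strict
    ι (2 ℕ.^ p)              ≡⟨ 2^a≡ ⟨
    2^ (↥ a)                 <⟨ 2^p<x^d ⟩
    x ^ d                    ≤⟨ ^-mono-≤ d 0≤x x≤2^β ⟩
    ι (2 ℕ.^ β) ^ d          ≡⟨ ι-2^-* β d ⟨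
    ι (2 ℕ.^ (β ℕ.* d))      ≤⟨ ι-2^-mono (ι-cancel-≤ {β ℕ.* d} {p} (βd≤p β≤a)) ⟩
    ι (2 ℕ.^ p)              ∎)
    where
    open ≤-Reasoning
    d = ↧ₙ a
    p = proj₁ (numerator 0<a)
    ad≡p = proj₁ (proj₂ (numerator 0<a))
    2^a≡ = proj₂ (proj₂ (numerator 0<a))
    βd≤p : ι β ≤ a → ι (β ℕ.* d) ≤ ι p
    βd≤p β≤a = begin
      ι (β ℕ.* d)    ≡⟨ ι-* β d ⟩
      ι β * ι d      ≤⟨ *-monoˡ-≤ (0≤ι d) β≤a ⟩
      a * ι d        ≡⟨ ad≡p ⟩
      ι p            ∎

  log-lower : ∀ {a x} β → 0ℚ < a → x ^ (↧ₙ a) < 2^ (↥ a) → ι (2 ℕ.^ β) ≤ x → ι β < a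
  log-lower {a} {x} β 0<a x^d<2^p 2^β≤x = ≰⇒> λ a≤β → <-irrefl refl (begin-strict
    ι (2 ℕ.^ p)              ≤⟨ ι-2^-mono (ι-cancel-≤ {p} {β ℕ.* d} (p≤βd a≤β)) ⟩
    ι (2 ℕ.^ (β ℕ.* d))      ≡⟨ ι-2^-* β d ⟩
    ι (2 ℕ.^ β) ^ d          ≤⟨ ^-mono-≤ d (0≤ι (2 ℕ.^ β)) 2^β≤x ⟩
    x ^ d                    <⟨ x^d<2^p ⟩
    2^ (↥ a)                 ≡⟨ 2^a≡ ⟩
    ι (2 ℕ.^ p)              ∎)
    where
    open ≤-Reasoning
    d = ↧ₙ a
    p = proj₁ (numerator 0<a)
    ad≡p = proj₁ (proj₂ (numerator 0<a))
    2^a≡ = proj₂ (proj₂ (numerator 0<a))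
    p≤βd : a ≤ ι β → ι p ≤ ι (β ℕ.* d)
    p≤βd a≤β = begin
      ι p            ≡⟨ ad≡p ⟨
      a * ι d        ≤⟨ *-monoˡ-≤ (0≤ι d) a≤β ⟩
      ι β * ι d      ≡⟨ ι-* β d ⟨
      ι (β ℕ.* d)    ∎

  -- Clear both denominators: with `a = p / d` and `a′ = p′ / d′`, the power 2^(p d′) lies below
  -- x^(d d′), hence below y^(d d′), hence below 2^(p′ d).
  log-mono : ∀ {a a′ x y} → 0ℚ < a → 0ℚ < a′ → 0ℚ ≤ x → x ≤ y →
    2^ (↥ a) < x ^ (↧ₙ a) → y ^ (↧ₙ a′) < 2^ (↥ a′) → a < a′
  log-mono {a} {a′} {x} {y} 0<a 0<a′ 0≤x x≤y below above = ≰⇒> λ a′≤a → <-irrefl refl (begin-strict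
    ι (2 ℕ.^ (p ℕ.* d′))     ≡⟨ ι-2^-* p d′ ⟩
    ι (2 ℕ.^ p) ^ d′         <⟨ ^-mono-< d′ {{↧≢0 a′}} (0≤ι (2 ℕ.^ p)) (subst (_< x ^ d) 2^a≡ below) ⟩
    (x ^ d) ^ d′             ≤⟨ ^-mono-≤ d′ (0≤^ d 0≤x) (^-mono-≤ d 0≤x x≤y) ⟩
    (y ^ d) ^ d′
      ≡⟨ trans (^-* y d d′) (trans (cong (y ^_) (ℕ.*-comm d d′)) (sym (^-* y d′ d))) ⟩
    (y ^ d′) ^ d
      ≤⟨ ^-mono-≤ d (0≤^ d′ (≤-trans 0≤x x≤y)) (<⇒≤ (subst (y ^ d′ <_) 2^a≡′ above)) ⟩
    ι (2 ℕ.^ p′) ^ d         ≡⟨ ι-2^-* p′ d ⟨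
    ι (2 ℕ.^ (p′ ℕ.* d))     ≤⟨ ι-2^-mono (ι-cancel-≤ {p′ ℕ.* d} {p ℕ.* d′} (p′d≤pd′ a′≤a)) ⟩
    ι (2 ℕ.^ (p ℕ.* d′))     ∎)
    where
    open ≤-Reasoning
    d = ↧ₙ a
    d′ = ↧ₙ a′
    p = proj₁ (numerator 0<a)
    p′ = proj₁ (numerator 0<a′)
    ad≡p = proj₁ (proj₂ (numerator 0<a))
    ad≡p′ = proj₁ (proj₂ (numerator 0<a′))
    2^a≡ = proj₂ (proj₂ (numerator 0<a))
    2^a≡′ = proj₂ (proj₂ (numerator 0<a′))
    regroup : ∀ a d d′ → a * d′ * d ≡ a * d * d′
    regroup = solve-∀ ring
    p′d≤pd′ : a′ ≤ a → ι (p′ ℕ.* d) ≤ ι (p ℕ.* d′)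
    p′d≤pd′ a′≤a = begin
      ι (p′ ℕ.* d)          ≡⟨ ι-* p′ d ⟩
      ι p′ * ι d            ≡⟨ cong (_* ι d) ad≡p′ ⟨
      a′ * ι d′ * ι d       ≤⟨ *-monoˡ-≤ (0≤ι d) (*-monoˡ-≤ (0≤ι d′) a′≤a) ⟩
      a * ι d′ * ι d        ≡⟨ regroup a (ι d) (ι d′) ⟩
      a * ι d * ι d′        ≡⟨ cong (_* ι d′) ad≡p ⟩
      ι p * ι d′            ≡⟨ ι-* p d′ ⟨
      ι (p ℕ.* d′)          ∎

  floorℕ : ∀ {a} → 0ℚ ≤ a → ∃ λ k → ι k ≤ a × a < ι (ℕ.suc k)
  floorℕ {a@(mkℚ _ _ _)} 0≤a with 0≤↥ 0≤a
  ... | p , ↥a≡p = k ,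
    *-cancelˡ-≤ (0<ι↧ a) (begin
      ι d * ι k                  ≡⟨ trans (*-comm (ι d) (ι k)) (sym (ι-* k d)) ⟩
      ι (k ℕ.* d)                ≤⟨ ι-mono-≤ {k ℕ.* d} {p} (m/n*n≤m p d) ⟩
      ι p                        ≡⟨ p≡da ⟩
      ι d * a                    ∎) ,
    *-cancelˡ-< (0≤ι d) (begin-strict
      ι d * a                    ≡⟨ p≡da ⟨
      ι p                        <⟨ ι-mono-< {p} {ℕ.suc k ℕ.* d} p<[1+k]d ⟩
      ι (ℕ.suc k ℕ.* d)          ≡⟨ trans (ι-* (ℕ.suc k) d) (*-comm (ι (ℕ.suc k)) (ι d)) ⟩
      ι d * ι (ℕ.suc k)          ∎)
    where
    open ≤-Reasoning
    d = ↧ₙ a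
    k = p ℕ./ d
    p≡da : ι p ≡ ι d * a
    p≡da = trans (sym (trans (*-denominator a) (trans (cong ιᶻ ↥a≡p) (ιᶻ-+ p)))) (*-comm a (ι d))
    p<[1+k]d : p ℕ.< ℕ.suc k ℕ.* d
    p<[1+k]d = subst (ℕ._< ℕ.suc k ℕ.* d) (sym (m≡m%n+[m/n]*n p d)) (ℕ.+-monoˡ-< (k ℕ.* d) (m%n<n p d))

  n<2^n : ∀ n → n ℕ.< 2 ℕ.^ n
  n<2^n ℕ.zero    = ℕ.s≤s ℕ.z≤n
  n<2^n (ℕ.suc n) = ℕ.≤-trans (ℕ.+-mono-≤ (ℕ.m^n>0 2 n) (n<2^n n))
    (ℕ.≤-reflexive (cong (2 ℕ.^ n ℕ.+_) (sym (ℕ.+-identityʳ _))))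

  floor-log : ∀ {a} → 1ℚ ≤ a → ∃ λ k → ι (2 ℕ.^ k) ≤ a × a < ι (2 ℕ.^ ℕ.suc k)
  -- The downward search starts at the floor of `a`, where `n<2^n` guarantees a power of two above
  -- `a`.
  floor-log {a} 1≤a = search (proj₁ ⌊a⌋) (<-≤-trans (proj₂ (proj₂ ⌊a⌋)) (ι-mono-≤ (ℕ.<⇒≤ (n<2^n (ℕ.suc (proj₁ ⌊a⌋))))))
    where
    ⌊a⌋ = floorℕ (≤-trans (from-yes (0ℚ ≤? 1ℚ)) 1≤a)
    search : ∀ K → a < ι (2 ℕ.^ ℕ.suc K) → ∃ λ k → ι (2 ℕ.^ k) ≤ a × a < ι (2 ℕ.^ ℕ.suc k)
    search ℕ.zero    a<  = 0 , ≤-trans (≤-reflexive ι-1) 1≤a , a<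
    search (ℕ.suc K) a< = step (ι (2 ℕ.^ ℕ.suc K) ≤? a)
      where
      step : Dec (ι (2 ℕ.^ ℕ.suc K) ≤ a) → ∃ λ k → ι (2 ℕ.^ k) ≤ a × a < ι (2 ℕ.^ ℕ.suc k)
      step (yes 2^K≤a) = ℕ.suc K , 2^K≤a , a<
      step (no  2^K≰a) = search K (≰⇒> 2^K≰a)

-- Bits of memory from the counting inequality, and the parameter regimes.

module MemoryBits where

  open import Data.Nat.Base
  open import Data.Nat.Properties
  open import Data.Nat.Tactic.RingSolver using (solve-∀)
  open import Data.Integer.Base using (+_)
  open RationalArithmetic using (ι)

  2^-cancel-≤ : ∀ {m n} → 2 ^ m ≤ 2 ^ n → m ≤ n
  2^-cancel-≤ le = ≮⇒≥ (λ n<m → <⇒≱ (^-monoʳ-< 2 (s≤s (s≤s z≤n)) n<m) le)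

  -- For k = 2 this is 243 ≤ 256, where rounding 2k - 1 up to 2k would be fatal. From k = 4 on the
  -- rounding is harmless: 32 ≤ k^3.
  [2^[1+β]+κ]^5≤ : ∀ β κ → suc κ ≡ 2 ^ suc β → (suc κ + κ) ^ 5 ≤ suc κ ^ 8
  [2^[1+β]+κ]^5≤ zero    1 refl = <⇒≤ (≤ᵇ⇒≤ 244 256 _)
  [2^[1+β]+κ]^5≤ (suc β) κ k≡ = begin
    (k + κ) ^ 5        ≤⟨ ^-monoˡ-≤ 5 (+-monoʳ-≤ k (n≤1+n κ)) ⟩
    (k + k) ^ 5        ≡⟨ regroup k ⟩
    32 * k ^ 5         ≤⟨ *-monoˡ-≤ (k ^ 5) (≤-trans (≤ᵇ⇒≤ 32 64 _) (^-monoˡ-≤ 3 4≤k)) ⟩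
    k ^ 3 * k ^ 5      ≡⟨ ^-distribˡ-+-* k 3 5 ⟨
    k ^ 8              ∎
    where
    open ≤-Reasoning
    k = suc κ
    4≤k : 4 ≤ k
    4≤k = subst (4 ≤_) (sym k≡) (^-monoʳ-≤ 2 (s≤s (s≤s (z≤n {β}))))
    regroup : ∀ k → (k + k) * ((k + k) * ((k + k) * ((k + k) * ((k + k) * 1)))) ≡ 32 * (k * (k * (k * (k * (k * 1)))))
    regroup = solve-∀

  -- With 10t letters the left side carries k^(19t), and the power of 2k - 1 on the right is at most
  -- k^(16t). The quotient k^(3t) is left for `2 ^ S`.
  bits≤S : ∀ S β κ t → suc κ ≡ 2 ^ suc β →
    suc κ ^ (9 * t) * suc κ ^ (10 * t) * (10 + κ * 0) ≤ 10 * (2 ^ S * (suc κ + κ) ^ (10 * t)) →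
    3 * t * suc β ≤ S
  bits≤S S β κ t k≡ bound = 2^-cancel-≤ (begin
    2 ^ (3 * t * suc β)      ≡⟨ cong (2 ^_) (*-comm (3 * t) (suc β)) ⟩
    2 ^ (suc β * (3 * t))    ≡⟨ ^-*-assoc 2 (suc β) (3 * t) ⟨
    (2 ^ suc β) ^ (3 * t)    ≡⟨ cong (_^ (3 * t)) k≡ ⟨
    k ^ (3 * t)
      ≤⟨ *-cancelʳ-≤ _ _ (10 * p) {{m*n≢0 10 p {{_}} {{m^n≢0 k (16 * t)}}}} cancelled ⟩
    2 ^ S                    ∎)
    where
    open ≤-Reasoning
    k = suc κ
    p = k ^ (16 * t)
    power : (k + κ) ^ (10 * t) ≤ p
    power = begin
      (k + κ) ^ (10 * t)           ≡⟨ cong ((k + κ) ^_) (*-assoc 5 2 t) ⟩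
      (k + κ) ^ (5 * (2 * t))      ≡⟨ ^-*-assoc (k + κ) 5 (2 * t) ⟨
      ((k + κ) ^ 5) ^ (2 * t)      ≤⟨ ^-monoˡ-≤ (2 * t) ([2^[1+β]+κ]^5≤ β κ k≡) ⟩
      (k ^ 8) ^ (2 * t)            ≡⟨ ^-*-assoc k 8 (2 * t) ⟩
      k ^ (8 * (2 * t))            ≡⟨ cong (k ^_) (*-assoc 8 2 t) ⟨
      p                            ∎
    cancelled : k ^ (3 * t) * (10 * p) ≤ 2 ^ S * (10 * p)
    cancelled = begin
      k ^ (3 * t) * (10 * p)                          ≡⟨ pull (k ^ (3 * t)) p ⟩
      k ^ (3 * t) * p * 10                            ≡⟨ cong (_* 10) (^-distribˡ-+-* k (3 * t) (16 * t)) ⟨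
      k ^ (3 * t + 16 * t) * 10                       ≡⟨ cong (λ h → k ^ h * 10) (exponent t) ⟩
      k ^ (9 * t + 10 * t) * 10
        ≡⟨ cong₂ _*_ (^-distribˡ-+-* k (9 * t) (10 * t)) (cong (λ z → 10 + z) (sym (*-zeroʳ κ))) ⟩
      k ^ (9 * t) * k ^ (10 * t) * (10 + κ * 0)       ≤⟨ bound ⟩
      10 * (2 ^ S * (k + κ) ^ (10 * t))               ≤⟨ *-monoʳ-≤ 10 (*-monoʳ-≤ (2 ^ S) power) ⟩
      10 * (2 ^ S * p)                                ≡⟨ push (2 ^ S) p ⟩
      2 ^ S * (10 * p)                                ∎
      where
      pull : ∀ a p → a * (10 * p) ≡ a * p * 10
      pull = solve-∀
      exponent : ∀ t → 3 * t + 16 * t ≡ 9 * t + 10 * t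
      exponent = solve-∀
      push : ∀ a p → 10 * (a * p) ≡ a * (10 * p)
      push = solve-∀

  module _ {U S : ℕ} {{_ : NonZero U}} (A : Algorithm U S) {ε δ : Cut} {e b a : ℚ} {n : ℕ}
           (E : IsReal ε) (0<e : 0ℚ ℚ.< e) (εe : lower ε e) (εb : upper ε b)
           (D : IsReal δ) (δa : upper δ a) (a<⅒ : a ℚ.< + 1 ℚ./ 10)
           (solves : SolvesAQ ε δ n U A) where

    private
      bound = Reduction.memory-bound A E 0<e εe εb D δa a<⅒ solves

    many-bits : ∀ β M L → 1 ≤ M → b ℚ.* ι (80 * M) ℚ.≤ 1ℚ → 40 * (M * 2 ^ L) ≤ n →
      L * (10 * M) * 2 ^ suc β ≤ U → 3 * (L * M) * suc β ≤ S
    many-bits β M@(suc _) L _ fine 40M2ᴸ≤n fits = bits≤S S β κ (L * M) k≡ (subst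
      (λ T → suc κ ^ (9 * (L * M)) * suc κ ^ T * (10 + κ * 0) ≤ 10 * (2 ^ S * (suc κ + κ) ^ T))
      (regroup₁ L M)
      -- Taking `10 * M` makes the number of letters a multiple of ten, so nine tenths of it is an
      -- integer and the remainder is 0.
      (bound κ (10 * M) L (subst (λ h → b ℚ.* ι h ℚ.≤ 1ℚ) (*-assoc 8 10 M) fine)
        (subst (_≤ n) (regroup₂ M (2 ^ L)) 40M2ᴸ≤n) (subst (λ k → L * (10 * M) * k ≤ U) (sym k≡) fits)
        (9 * (L * M)) 0 (regroup₃ L M)))
      where
      κ = pred (2 ^ suc β)
      k≡ : suc κ ≡ 2 ^ suc β
      k≡ = suc-pred (2 ^ suc β) {{m^n≢0 2 (suc β)}}
      regroup₁ : ∀ L M → L * (10 * M) ≡ 10 * (L * M)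
      regroup₁ = solve-∀
      regroup₂ : ∀ M p → 40 * (M * p) ≡ 4 * (10 * M * p)
      regroup₂ = solve-∀
      regroup₃ : ∀ L M → 9 * (L * (10 * M)) ≡ 10 * (9 * (L * M)) + 0
      regroup₃ = solve-∀

    -- For universes too small for ten letters. With one letter from an alphabet of two and `S = 0`,
    -- the counting inequality would read 38 ≤ 30; the fractional part `ρ = 9` is essential here.
    one-bit : b ℚ.* ι 8 ℚ.≤ 1ℚ → 8 ≤ n → 2 ≤ U → 1 ≤ S
    one-bit fine 8≤n 2≤U = n≢0⇒n>0 λ { refl → <⇒≱ (≤ᵇ⇒≤ 31 38 _) (bound 1 1 1 fine 8≤n 2≤U 0 9 refl) }

-- The rationals below bracket the reals of the theorem: e < ε < b, r < 1 / ε,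
-- l < log₂ (ε n) < b₂, h < 1 / log₂ (ε n) and f < log₂ (ε U / log₂ (ε n)).
module Endgame
  {e b r l f h b₂ w w₂ w′ : ℚ} {n U S : ℕ}
  (0<e : 0ℚ ℚ.< e) (e<b : e ℚ.< b) (b<ε₀ : b ℚ.< ℤ.+ 1 ℚ./ 80)
  (1<en : 1ℚ ℚ.< e ℚ.* RationalArithmetic.ι n)
  (0<r : 0ℚ ℚ.< r) (rb<1 : r ℚ.* b ℚ.< 1ℚ)
  (0<l : 0ℚ ℚ.< l) (2^l<w : 2^ (ℚ.↥ l) ℚ.< w Defs.^ (ℚ.↧ₙ l))
  (0<w : 0ℚ ℚ.< w) (w<en : w ℚ.< e ℚ.* RationalArithmetic.ι n)
  (0<b₂ : 0ℚ ℚ.< b₂) (w₂<2^b₂ : w₂ Defs.^ (ℚ.↧ₙ b₂) ℚ.< 2^ (ℚ.↥ b₂))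
  (en<w₂ : e ℚ.* RationalArithmetic.ι n ℚ.< w₂)
  (0<h : 0ℚ ℚ.< h) (hb₂<1 : h ℚ.* b₂ ℚ.< 1ℚ)
  (0<f : 0ℚ ℚ.< f) (2^f<w′ : 2^ (ℚ.↥ f) ℚ.< w′ Defs.^ (ℚ.↧ₙ f))
  (0<w′ : 0ℚ ℚ.< w′) (w′<bUh : w′ ℚ.< b ℚ.* RationalArithmetic.ι U ℚ.* h)
  (2≤U : 2 ℕ.≤ U)
  (many-bits : ∀ β M L → 1 ℕ.≤ M → b ℚ.* RationalArithmetic.ι (80 ℕ.* M) ℚ.≤ 1ℚ →
    40 ℕ.* (M ℕ.* 2 ℕ.^ L) ℕ.≤ n → L ℕ.* (10 ℕ.* M) ℕ.* 2 ℕ.^ ℕ.suc β ℕ.≤ U →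
    3 ℕ.* (L ℕ.* M) ℕ.* ℕ.suc β ℕ.≤ S)
  (one-bit : b ℚ.* RationalArithmetic.ι 8 ℚ.≤ 1ℚ → 8 ℕ.≤ n → 2 ℕ.≤ U → 1 ℕ.≤ S)
  where

  open import Data.Integer.Base using (+_)
  open import Data.Rational.Base
  open import Data.Rational.Properties
  open RationalArithmetic
  open Logarithms
  open RingSolver using (solve-∀)

  private
    opaque
      unfolding ι

      80*[y/80]≡y : ∀ y → ι 80 * (y * (+ 1 / 80)) ≡ y
      80*[y/80]≡y = solve-∀ ring

      1/80*8≤1 : + 1 / 80 * ι 8 ≤ 1ℚ
      1/80*8≤1 = from-yes (+ 1 / 80 * ι 8 ≤? 1ℚ)

    0<b : 0ℚ < b
    0<b = <-trans 0<e e<b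

    0≤bU : 0ℚ ≤ b * ι U
    0≤bU = 0≤* (<⇒≤ 0<b) (0≤ι U)

    hl<1 : h * l < 1ℚ
    hl<1 = <-trans (*-monoʳ-< 0<h (log-mono 0<l 0<b₂ (<⇒≤ 0<w) (<⇒≤ (<-trans w<en en<w₂)) 2^l<w w₂<2^b₂)) hb₂<1

    1≤w′ : 1ℚ ≤ w′
    1≤w′ = ≮⇒≥ (λ w′<1 → <-asym 0<f (subst (f <_) ι-0
      (log-upper 0 0<f (<⇒≤ 0<w′) 2^f<w′ (<⇒≤ (subst (w′ <_) (sym ι-1) w′<1)))))

    Goal : Set
    Goal = r * l * f ≤ ι (200 ℕ.* S)

    product-bound : ∀ {R L F} → r ≤ ι R → l ≤ ι L → f ≤ ι F → R ℕ.* L ℕ.* F ℕ.≤ 200 ℕ.* S → Goal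
    product-bound {R} {L} {F} r≤R l≤L f≤F RLF≤ = begin
      r * l * f
        ≤⟨ *-mono-≤ (0≤* (<⇒≤ 0<r) (<⇒≤ 0<l)) (0≤ι F) (*-mono-≤ (<⇒≤ 0<r) (0≤ι L) r≤R l≤L) f≤F ⟩
      ι R * ι L * ι F        ≡⟨ cong (_* ι F) (ι-* R L) ⟨
      ι (R ℕ.* L) * ι F      ≡⟨ ι-* (R ℕ.* L) F ⟨
      ι (R ℕ.* L ℕ.* F)      ≤⟨ ι-mono-≤ RLF≤ ⟩
      ι (200 ℕ.* S)          ∎
      where open ≤-Reasoning

    scale : ∀ K m x → b * ι K ≤ 1ℚ → x ≤ b * ι m → ι K * x ≤ ι m
    scale K m x bK≤1 x≤bm = begin
      ι K * x              ≤⟨ *-monoʳ-≤ (0≤ι K) x≤bm ⟩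
      ι K * (b * ι m)      ≡⟨ regroup (ι K) b (ι m) ⟩
      b * ι K * ι m        ≤⟨ *-monoˡ-≤ (0≤ι m) bK≤1 ⟩
      1ℚ * ι m             ≡⟨ *-identityˡ (ι m) ⟩
      ι m                  ∎
      where
      open ≤-Reasoning
      regroup : ∀ k b m → k * (b * m) ≡ b * k * m
      regroup = solve-∀ ring

    fits-n : ∀ M λ′ → b * ι (80 ℕ.* M) ≤ 1ℚ → ι (2 ℕ.^ λ′) ≤ e * ι n → 40 ℕ.* (M ℕ.* 2 ℕ.^ ℕ.suc λ′) ℕ.≤ n
    fits-n M λ′ fine 2^λ≤en = ι-cancel-≤ {40 ℕ.* (M ℕ.* 2 ℕ.^ ℕ.suc λ′)} {n} (begin
      ι (40 ℕ.* (M ℕ.* (2 ℕ.* 2 ℕ.^ λ′)))   ≡⟨ cong ι (regroup M (2 ℕ.^ λ′)) ⟩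
      ι (80 ℕ.* M ℕ.* 2 ℕ.^ λ′)             ≡⟨ ι-* (80 ℕ.* M) (2 ℕ.^ λ′) ⟩
      ι (80 ℕ.* M) * ι (2 ℕ.^ λ′)           ≤⟨ scale (80 ℕ.* M) n (ι (2 ℕ.^ λ′)) fine
                                                 (≤-trans 2^λ≤en (*-monoˡ-≤ (0≤ι n) (<⇒≤ e<b))) ⟩
      ι n                                   ∎)
      where
      open ≤-Reasoning
      regroup : ∀ M p → 40 ℕ.* (M ℕ.* (2 ℕ.* p)) ≡ 80 ℕ.* M ℕ.* p
      regroup = ℕ-Solver.solve-∀

    -- `M` is the floor of 1 / (80 b), positive because `b < 1/80`. Rounding a number that is at
    -- least 1 loses at most a factor 2, hence 160.
    resolution : ∃ λ M → 1 ℕ.≤ M × b * ι (80 ℕ.* M) ≤ 1ℚ × r ≤ ι (160 ℕ.* M)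
    resolution = M , 1≤M , fine , r≤160M
      where
      open ≤-Reasoning
      y = proj₁ (inverse 0<b)
      0<y = proj₁ (proj₂ (inverse 0<b))
      yb≡1 = proj₂ (proj₂ (inverse 0<b))
      ⌊y/80⌋ = floorℕ {y * (+ 1 / 80)} (0≤* (<⇒≤ 0<y) (from-yes (0ℚ ≤? + 1 / 80)))
      M = proj₁ ⌊y/80⌋
      80M≤y : ι (80 ℕ.* M) ≤ y
      80M≤y = begin
        ι (80 ℕ.* M)              ≡⟨ ι-* 80 M ⟩
        ι 80 * ι M                ≤⟨ *-monoʳ-≤ (0≤ι 80) (proj₁ (proj₂ ⌊y/80⌋)) ⟩
        ι 80 * (y * (+ 1 / 80))   ≡⟨ 80*[y/80]≡y y ⟩
        y                         ∎
      y<80[1+M] : y < ι (80 ℕ.* ℕ.suc M)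
      y<80[1+M] = begin-strict
        y                         ≡⟨ 80*[y/80]≡y y ⟨
        ι 80 * (y * (+ 1 / 80))   <⟨ *-monoʳ-< (0<ι (ℕ.s≤s ℕ.z≤n)) (proj₂ (proj₂ ⌊y/80⌋)) ⟩
        ι 80 * ι (ℕ.suc M)        ≡⟨ ι-* 80 (ℕ.suc M) ⟨
        ι (80 ℕ.* ℕ.suc M)        ∎
      fine : b * ι (80 ℕ.* M) ≤ 1ℚ
      fine = begin
        b * ι (80 ℕ.* M)      ≤⟨ *-monoʳ-≤ (<⇒≤ 0<b) 80M≤y ⟩
        b * y                 ≡⟨ *-comm b y ⟩
        y * b                 ≡⟨ yb≡1 ⟩
        1ℚ                    ∎
      1≤M : 1 ℕ.≤ M
      1≤M = ℕ.n≢0⇒n>0 λ M≡0 → <-irrefl refl (begin-strict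
        1ℚ                    ≡⟨ yb≡1 ⟨
        y * b                 <⟨ *-monoˡ-< 0<b (subst (λ m → y < ι (80 ℕ.* ℕ.suc m)) M≡0 y<80[1+M]) ⟩
        ι 80 * b              <⟨ *-monoʳ-< (0<ι (ℕ.s≤s ℕ.z≤n)) b<ε₀ ⟩
        ι 80 * (+ 1 / 80)     ≡⟨ cong (ι 80 *_) (*-identityˡ (+ 1 / 80)) ⟨
        ι 80 * (1ℚ * (+ 1 / 80)) ≡⟨ 80*[y/80]≡y 1ℚ ⟩
        1ℚ                    ∎)
      r≤160M : r ≤ ι (160 ℕ.* M)
      r≤160M = begin
        r                     ≡⟨ *-identityʳ r ⟨
        r * 1ℚ                ≡⟨ cong (r *_) yb≡1 ⟨
        r * (y * b)           ≡⟨ regroup r y b ⟩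
        r * b * y             ≤⟨ *-monoˡ-≤ (<⇒≤ 0<y) (<⇒≤ rb<1) ⟩
        1ℚ * y                ≡⟨ *-identityˡ y ⟩
        y                     ≤⟨ <⇒≤ y<80[1+M] ⟩
        ι (80 ℕ.* ℕ.suc M)    ≤⟨ ι-mono-≤ {80 ℕ.* ℕ.suc M} {160 ℕ.* M} doubled ⟩
        ι (160 ℕ.* M)         ∎
        where
        regroup : ∀ r y b → r * (y * b) ≡ r * b * y
        regroup = solve-∀ ring
        doubled : 80 ℕ.* ℕ.suc M ℕ.≤ 160 ℕ.* M
        doubled = ℕ.≤-trans (ℕ.*-monoʳ-≤ 80 (ℕ.+-monoˡ-≤ M 1≤M)) (ℕ.≤-reflexive (eq M))
          where
          eq : ∀ M → 80 ℕ.* (M ℕ.+ M) ≡ 160 ℕ.* M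
          eq = ℕ-Solver.solve-∀

    ⌊log⌋w′ = floor-log 1≤w′
    μ = proj₁ ⌊log⌋w′

    f<1+μ : f < ι (ℕ.suc μ)
    f<1+μ = log-upper (ℕ.suc μ) 0<f (<⇒≤ 0<w′) 2^f<w′ (<⇒≤ (proj₂ (proj₂ ⌊log⌋w′)))

    -- log₂ (ε n) ≥ 1
    many-scales : ∀ λ′ → ι (2 ℕ.^ ℕ.suc λ′) ≤ e * ι n → e * ι n < ι (2 ℕ.^ ℕ.suc (ℕ.suc λ′)) → Goal
    many-scales λ′ 2^λ≤en en<2^L = product-bound {160 ℕ.* M} {L} {ℕ.suc μ} (proj₂ (proj₂ (proj₂ resolution)))
      (<⇒≤ (log-upper L 0<l (<⇒≤ 0<w) 2^l<w (<⇒≤ (<-trans w<en en<2^L)))) (<⇒≤ f<1+μ)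
      (ℕ.≤-trans (counted M L (ℕ.suc μ)) (ℕ.*-monoʳ-≤ 200
        (many-bits μ M L (proj₁ (proj₂ resolution)) fine (fits-n M (ℕ.suc λ′) fine 2^λ≤en) fits-U)))
      where
      open ≤-Reasoning
      λ₀ = ℕ.suc λ′
      L = ℕ.suc λ₀
      M = proj₁ resolution
      fine = proj₁ (proj₂ (proj₂ resolution))
      counted : ∀ M L F → 160 ℕ.* M ℕ.* L ℕ.* F ℕ.≤ 200 ℕ.* (3 ℕ.* (L ℕ.* M) ℕ.* F)
      counted M L F = ℕ.≤-trans (ℕ.m≤m+n _ (440 ℕ.* (M ℕ.* L ℕ.* F))) (ℕ.≤-reflexive (eq M L F))
        where
        eq : ∀ M L F → 160 ℕ.* M ℕ.* L ℕ.* F ℕ.+ 440 ℕ.* (M ℕ.* L ℕ.* F) ≡ 200 ℕ.* (3 ℕ.* (L ℕ.* M) ℕ.* F)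
        eq = ℕ-Solver.solve-∀
      hλ≤1 : h * ι λ₀ ≤ 1ℚ
      hλ≤1 = <⇒≤ (<-trans (*-monoʳ-< 0<h (log-lower λ₀ 0<b₂ w₂<2^b₂ (≤-trans 2^λ≤en (<⇒≤ en<w₂)))) hb₂<1)
      -- The division by log₂ (ε n) inside the last logarithm pays for the `λ₀` scales, since `h`
      -- times `λ₀` is at most 1.
      λ2^μ≤bU : ι (λ₀ ℕ.* 2 ℕ.^ μ) ≤ b * ι U
      λ2^μ≤bU = begin
        ι (λ₀ ℕ.* 2 ℕ.^ μ)         ≡⟨ ι-* λ₀ (2 ℕ.^ μ) ⟩
        ι λ₀ * ι (2 ℕ.^ μ)         ≤⟨ *-monoʳ-≤ (0≤ι λ₀) (≤-trans (proj₁ (proj₂ ⌊log⌋w′)) (<⇒≤ w′<bUh)) ⟩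
        ι λ₀ * (b * ι U * h)       ≡⟨ regroup (ι λ₀) (b * ι U) h ⟩
        h * ι λ₀ * (b * ι U)       ≤⟨ *-monoˡ-≤ 0≤bU hλ≤1 ⟩
        1ℚ * (b * ι U)             ≡⟨ *-identityˡ (b * ι U) ⟩
        b * ι U                    ∎
        where
        regroup : ∀ x y h → x * (y * h) ≡ h * x * y
        regroup = solve-∀ ring
      fits-U : L ℕ.* (10 ℕ.* M) ℕ.* 2 ℕ.^ ℕ.suc μ ℕ.≤ U
      fits-U = ι-cancel-≤ {L ℕ.* (10 ℕ.* M) ℕ.* 2 ℕ.^ ℕ.suc μ} {U} (begin
        ι (L ℕ.* (10 ℕ.* M) ℕ.* (2 ℕ.* 2 ℕ.^ μ))   ≤⟨ ι-mono-≤ (wide λ′ M (2 ℕ.^ μ)) ⟩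
        ι (80 ℕ.* M ℕ.* (λ₀ ℕ.* 2 ℕ.^ μ))          ≡⟨ ι-* (80 ℕ.* M) (λ₀ ℕ.* 2 ℕ.^ μ) ⟩
        ι (80 ℕ.* M) * ι (λ₀ ℕ.* 2 ℕ.^ μ)          ≤⟨ scale (80 ℕ.* M) U _ fine λ2^μ≤bU ⟩
        ι U                                        ∎)
        where
        -- Relies on `λ₀ ≥ 1`, so that `L = λ₀ + 1` is at most `2 λ₀`. At `λ₀ = 0` the right side
        -- would vanish, whence the separate treatment of that scale.
        wide : ∀ λ′ M p → ℕ.suc (ℕ.suc λ′) ℕ.* (10 ℕ.* M) ℕ.* (2 ℕ.* p) ℕ.≤ 80 ℕ.* M ℕ.* (ℕ.suc λ′ ℕ.* p)
        wide λ′ M p = ℕ.≤-trans (ℕ.m≤m+n _ ((60 ℕ.* λ′ ℕ.+ 40) ℕ.* (M ℕ.* p))) (ℕ.≤-reflexive (eq λ′ M p))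
          where
          eq : ∀ λ′ M p → ℕ.suc (ℕ.suc λ′) ℕ.* (10 ℕ.* M) ℕ.* (2 ℕ.* p) ℕ.+ (60 ℕ.* λ′ ℕ.+ 40) ℕ.* (M ℕ.* p)
               ≡ 80 ℕ.* M ℕ.* (ℕ.suc λ′ ℕ.* p)
          eq = ℕ-Solver.solve-∀

    lw′≤bU : l * w′ ≤ b * ι U
    lw′≤bU = begin
      l * w′               ≤⟨ *-monoʳ-≤ (<⇒≤ 0<l) (<⇒≤ w′<bUh) ⟩
      l * (b * ι U * h)    ≡⟨ regroup l (b * ι U) h ⟩
      h * l * (b * ι U)    ≤⟨ *-monoˡ-≤ 0≤bU (<⇒≤ hl<1) ⟩
      1ℚ * (b * ι U)       ≡⟨ *-identityˡ (b * ι U) ⟩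
      b * ι U              ∎
      where
      open ≤-Reasoning
      regroup : ∀ x y h → x * (y * h) ≡ h * x * y
      regroup = solve-∀ ring

    -- log₂ (ε n) < 1, where log₂ (1 / log₂ (ε n)) may dominate log₂ (ε U).
    one-scale : ι 1 ≤ e * ι n → e * ι n < ι 2 → 1ℚ ≤ ι 4 * (b * ι U) → Goal
    one-scale 1≤en en<2 1≤4bU = begin
      r * l * f                                ≡⟨ *-assoc r l f ⟩
      r * (l * f)
        ≤⟨ *-mono-≤ (<⇒≤ 0<r) (0≤ι (3 ℕ.* ℕ.suc β)) (proj₂ (proj₂ (proj₂ resolution))) lf≤ ⟩
      ι (160 ℕ.* M) * ι (3 ℕ.* ℕ.suc β)        ≡⟨ ι-* (160 ℕ.* M) (3 ℕ.* ℕ.suc β) ⟨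
      ι (160 ℕ.* M ℕ.* (3 ℕ.* ℕ.suc β))        ≤⟨ ι-mono-≤ (ℕ.≤-trans (counted M (ℕ.suc β))
             (ℕ.*-monoʳ-≤ 200 (many-bits β M 1 (proj₁ (proj₂ resolution)) fine (fits-n M 0 fine 1≤en) fits-U))) ⟩
      ι (200 ℕ.* S)                            ∎
      where
      open ≤-Reasoning
      M = proj₁ resolution
      fine = proj₁ (proj₂ (proj₂ resolution))
      -- `10 * M` blocks of `2 ^ suc β` items fit into `U` as soon as `2 ^ β` is at most 4 b U,
      -- because 80 M b ≤ 1.
      ⌊log⌋4bU = floor-log 1≤4bU
      β = proj₁ ⌊log⌋4bU
      1/l = inverse 0<l
      y = proj₁ 1/l
      ⌊1/l⌋ = floorℕ {y} (<⇒≤ (proj₁ (proj₂ 1/l)))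
      -- A deliberately crude bound for the logarithm of 1/l: on the one hand 1/l < γ + 1 ≤ 2^(γ +
      -- 1), on the other `l * γ ≤ 1`. So the factor `l` absorbs what a small log₂ (ε n) adds to
      -- `f`.
      γ = proj₁ ⌊1/l⌋
      lγ≤1 : l * ι γ ≤ 1ℚ
      lγ≤1 = ≤-trans (*-monoʳ-≤ (<⇒≤ 0<l) (proj₁ (proj₂ ⌊1/l⌋))) (≤-reflexive (trans (*-comm l y) (proj₂ (proj₂ 1/l))))
      1≤l[1+γ] : 1ℚ ≤ l * ι (ℕ.suc γ)
      1≤l[1+γ] = ≤-trans (≤-reflexive (sym (trans (*-comm l y) (proj₂ (proj₂ 1/l)))))
        (*-monoʳ-≤ (<⇒≤ 0<l) (<⇒≤ (proj₂ (proj₂ ⌊1/l⌋))))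
      l≤1 : l ≤ ι 1
      l≤1 = <⇒≤ (log-upper 1 0<l (<⇒≤ 0<w) 2^l<w (<⇒≤ (<-trans w<en en<2)))
      counted : ∀ M F → 160 ℕ.* M ℕ.* (3 ℕ.* F) ℕ.≤ 200 ℕ.* (3 ℕ.* (1 ℕ.* M) ℕ.* F)
      counted M F = ℕ.≤-trans (ℕ.m≤m+n _ (120 ℕ.* (M ℕ.* F))) (ℕ.≤-reflexive (eq M F))
        where
        eq : ∀ M F → 160 ℕ.* M ℕ.* (3 ℕ.* F) ℕ.+ 120 ℕ.* (M ℕ.* F) ≡ 200 ℕ.* (3 ℕ.* (1 ℕ.* M) ℕ.* F)
        eq = ℕ-Solver.solve-∀
      bU≤2^[1+β] : b * ι U ≤ ι (2 ℕ.^ ℕ.suc β)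
      bU≤2^[1+β] = begin
        b * ι U                    ≡⟨ *-identityˡ (b * ι U) ⟨
        1ℚ * (b * ι U)
          ≤⟨ *-monoˡ-≤ 0≤bU (≤-trans (≤-reflexive (sym ι-1)) (ι-mono-≤ (ℕ.s≤s (ℕ.z≤n {3})))) ⟩
        ι 4 * (b * ι U)            ≤⟨ <⇒≤ (proj₂ (proj₂ ⌊log⌋4bU)) ⟩
        ι (2 ℕ.^ ℕ.suc β)          ∎
      w′≤2^ : w′ ≤ ι (2 ℕ.^ (ℕ.suc β ℕ.+ ℕ.suc γ))
      w′≤2^ = begin
        w′                                           ≡⟨ *-identityʳ w′ ⟨
        w′ * 1ℚ                                      ≤⟨ *-monoʳ-≤ (<⇒≤ 0<w′) 1≤l[1+γ] ⟩
        w′ * (l * ι (ℕ.suc γ))                       ≡⟨ regroup w′ l (ι (ℕ.suc γ)) ⟩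
        l * w′ * ι (ℕ.suc γ)
          ≤⟨ *-mono-≤ (0≤* (<⇒≤ 0<l) (<⇒≤ 0<w′)) (0≤ι (2 ℕ.^ ℕ.suc γ)) (≤-trans lw′≤bU bU≤2^[1+β])
                                                          (ι-mono-≤ {ℕ.suc γ} {2 ℕ.^ ℕ.suc γ} (ℕ.<⇒≤ (n<2^n (ℕ.suc γ)))) ⟩
        ι (2 ℕ.^ ℕ.suc β) * ι (2 ℕ.^ ℕ.suc γ)        ≡⟨ ι-* (2 ℕ.^ ℕ.suc β) (2 ℕ.^ ℕ.suc γ) ⟨
        ι (2 ℕ.^ ℕ.suc β ℕ.* 2 ℕ.^ ℕ.suc γ)          ≡⟨ cong ι (ℕ.^-distribˡ-+-* 2 (ℕ.suc β) (ℕ.suc γ)) ⟨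
        ι (2 ℕ.^ (ℕ.suc β ℕ.+ ℕ.suc γ))              ∎
        where
        regroup : ∀ w l g → w * (l * g) ≡ l * w * g
        regroup = solve-∀ ring
      lf≤ : l * f ≤ ι (3 ℕ.* ℕ.suc β)
      lf≤ = begin
        l * f
          ≤⟨ *-monoʳ-≤ (<⇒≤ 0<l) (<⇒≤ (log-upper (ℕ.suc β ℕ.+ ℕ.suc γ) 0<f (<⇒≤ 0<w′) 2^f<w′ w′≤2^)) ⟩
        l * ι (ℕ.suc β ℕ.+ ℕ.suc γ)                    ≡⟨ cong (λ m → l * ι m) (ℕ.+-suc (ℕ.suc β) γ) ⟩
        l * ι (ℕ.suc (ℕ.suc β) ℕ.+ γ)                  ≡⟨ cong (l *_) (ι-+ (ℕ.suc (ℕ.suc β)) γ) ⟩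
        l * (ι (ℕ.suc (ℕ.suc β)) + ι γ)                ≡⟨ *-distribˡ-+ l (ι (ℕ.suc (ℕ.suc β))) (ι γ) ⟩
        l * ι (ℕ.suc (ℕ.suc β)) + l * ι γ
          ≤⟨ +-mono-≤ (*-monoˡ-≤ (0≤ι (ℕ.suc (ℕ.suc β))) l≤1) (≤-trans lγ≤1 (≤-reflexive (sym ι-1))) ⟩
        ι 1 * ι (ℕ.suc (ℕ.suc β)) + ι 1
          ≡⟨ cong (_+ ι 1) (trans (cong (_* ι (ℕ.suc (ℕ.suc β))) ι-1) (*-identityˡ (ι (ℕ.suc (ℕ.suc β))))) ⟩
        ι (ℕ.suc (ℕ.suc β)) + ι 1                      ≡⟨ ι-+ (ℕ.suc (ℕ.suc β)) 1 ⟨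
        ι (ℕ.suc (ℕ.suc β) ℕ.+ 1)
          ≤⟨ ι-mono-≤ {ℕ.suc (ℕ.suc β) ℕ.+ 1} {3 ℕ.* ℕ.suc β} (three β) ⟩
        ι (3 ℕ.* ℕ.suc β)                              ∎
        where
        three : ∀ β → ℕ.suc (ℕ.suc β) ℕ.+ 1 ℕ.≤ 3 ℕ.* ℕ.suc β
        three β = ℕ.≤-trans (ℕ.m≤m+n _ (2 ℕ.* β)) (ℕ.≤-reflexive (eq β))
          where
          eq : ∀ β → ℕ.suc (ℕ.suc β) ℕ.+ 1 ℕ.+ 2 ℕ.* β ≡ 3 ℕ.* ℕ.suc β
          eq = ℕ-Solver.solve-∀
      fits-U : 1 ℕ.* (10 ℕ.* M) ℕ.* 2 ℕ.^ ℕ.suc β ℕ.≤ U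
      fits-U = ι-cancel-≤ {1 ℕ.* (10 ℕ.* M) ℕ.* 2 ℕ.^ ℕ.suc β} {U} (begin
        ι (1 ℕ.* (10 ℕ.* M) ℕ.* (2 ℕ.* 2 ℕ.^ β))   ≡⟨ cong ι (eq₁ M (2 ℕ.^ β)) ⟩
        ι (20 ℕ.* M ℕ.* 2 ℕ.^ β)                   ≡⟨ ι-* (20 ℕ.* M) (2 ℕ.^ β) ⟩
        ι (20 ℕ.* M) * ι (2 ℕ.^ β)                 ≤⟨ *-monoʳ-≤ (0≤ι (20 ℕ.* M)) (proj₁ (proj₂ ⌊log⌋4bU)) ⟩
        ι (20 ℕ.* M) * (ι 4 * (b * ι U))           ≡⟨ *-assoc (ι (20 ℕ.* M)) (ι 4) (b * ι U) ⟨
        ι (20 ℕ.* M) * ι 4 * (b * ι U)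
          ≡⟨ cong (_* (b * ι U)) (trans (sym (ι-* (20 ℕ.* M) 4)) (cong ι (eq₂ M))) ⟩
        ι (80 ℕ.* M) * (b * ι U)                   ≤⟨ scale (80 ℕ.* M) U (b * ι U) fine ≤-refl ⟩
        ι U                                        ∎)
        where
        eq₁ : ∀ M p → 1 ℕ.* (10 ℕ.* M) ℕ.* (2 ℕ.* p) ≡ 20 ℕ.* M ℕ.* p
        eq₁ = ℕ-Solver.solve-∀
        eq₂ : ∀ M → 20 ℕ.* M ℕ.* 4 ≡ 80 ℕ.* M
        eq₂ = ℕ-Solver.solve-∀

    -- U < 1 / (4 ε): the bound is at most of order U, which one-bit letters achieve.
    small-universe : ι 1 ≤ e * ι n → ι 4 * (b * ι U) ≤ 1ℚ → Goal
    small-universe 1≤en 4bU≤1 = begin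
      r * l * f              ≡⟨ *-assoc r l f ⟩
      r * (l * f)            ≤⟨ *-monoʳ-≤ (<⇒≤ 0<r) (*-monoʳ-≤ (<⇒≤ 0<l) f≤w′) ⟩
      r * (l * w′)           ≤⟨ *-monoʳ-≤ (<⇒≤ 0<r) lw′≤bU ⟩
      r * (b * ι U)          ≡⟨ *-assoc r b (ι U) ⟨
      r * b * ι U            ≤⟨ *-monoˡ-≤ (0≤ι U) (<⇒≤ rb<1) ⟩
      1ℚ * ι U               ≡⟨ *-identityˡ (ι U) ⟩
      ι U                    ≤⟨ ι-mono-≤ U≤200S ⟩
      ι (200 ℕ.* S)          ∎
      where
      open ≤-Reasoning
      f≤w′ : f ≤ w′
      f≤w′ = <⇒≤ (<-≤-trans f<1+μ (≤-trans (ι-mono-≤ {ℕ.suc μ} {2 ℕ.^ μ} (n<2^n μ)) (proj₁ (proj₂ ⌊log⌋w′))))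
      -- The number of letters is limited by `U` rather than by 1/ε: ten times `q` blocks of two
      -- items fit, and 80 q ≤ 4 U ≤ 1/b keeps the resolution admissible.
      q = U ℕ./ 20
      U<20[1+q] : U ℕ.< 20 ℕ.* ℕ.suc q
      U<20[1+q] = subst (U ℕ.<_) (ℕ.*-comm (ℕ.suc q) 20)
        (subst (ℕ._< ℕ.suc q ℕ.* 20) (sym (m≡m%n+[m/n]*n U 20)) (ℕ.+-monoˡ-< (q ℕ.* 20) (m%n<n U 20)))
      20q≤U : 20 ℕ.* q ℕ.≤ U
      20q≤U = subst (ℕ._≤ U) (ℕ.*-comm q 20) (m/n*n≤m U 20)
      b8≤1 : b * ι 8 ≤ 1ℚ
      b8≤1 = ≤-trans (*-monoˡ-≤ (0≤ι 8) (<⇒≤ b<ε₀)) 1/80*8≤1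
      8≤n : 8 ℕ.≤ n
      8≤n = ι-cancel-≤ {8} {n} (≤-trans (≤-reflexive (sym (*-identityʳ (ι 8)))) (scale 8 n 1ℚ b8≤1
        (≤-trans (≤-reflexive (sym ι-1)) (≤-trans 1≤en (*-monoˡ-≤ (0≤ι n) (<⇒≤ e<b))))))
      fine : b * ι (80 ℕ.* q) ≤ 1ℚ
      fine = begin
        b * ι (80 ℕ.* q)
          ≤⟨ *-monoʳ-≤ (<⇒≤ 0<b) (ι-mono-≤ (ℕ.≤-trans (ℕ.≤-reflexive (ℕ.*-assoc 4 20 q)) (ℕ.*-monoʳ-≤ 4 20q≤U))) ⟩
        b * ι (4 ℕ.* U)      ≡⟨ cong (b *_) (ι-* 4 U) ⟩
        b * (ι 4 * ι U)      ≡⟨ regroup b (ι 4) (ι U) ⟩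
        ι 4 * (b * ι U)      ≤⟨ 4bU≤1 ⟩
        1ℚ                   ∎
        where
        regroup : ∀ b x u → b * (x * u) ≡ x * (b * u)
        regroup = solve-∀ ring
      U≤200S : U ℕ.≤ 200 ℕ.* S
      U≤200S = by-size (q ℕ.≟ 0)
        where
        by-size : Dec (q ≡ 0) → U ℕ.≤ 200 ℕ.* S
        by-size (yes q≡0) = ℕ.≤-trans (ℕ.<⇒≤ (subst (λ q → U ℕ.< 20 ℕ.* ℕ.suc q) q≡0 U<20[1+q]))
          (ℕ.≤-trans (ℕ.≤ᵇ⇒≤ 20 200 _) (ℕ.*-monoʳ-≤ 200 (one-bit b8≤1 8≤n 2≤U)))
        by-size (no q≢0) = ℕ.≤-trans (ℕ.<⇒≤ U<20[1+q])
          (ℕ.≤-trans (ℕ.*-monoʳ-≤ 20 (ℕ.+-monoˡ-≤ q 1≤q)) (ℕ.≤-trans (counted q)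
            (ℕ.*-monoʳ-≤ 200 (many-bits 0 q 1 1≤q fine (fits-n q 0 fine 1≤en) (ℕ.≤-trans (ℕ.≤-reflexive (eq q)) 20q≤U)))))
          where
          1≤q = ℕ.n≢0⇒n>0 q≢0
          eq : ∀ q → 1 ℕ.* (10 ℕ.* q) ℕ.* 2 ≡ 20 ℕ.* q
          eq = ℕ-Solver.solve-∀
          counted : ∀ q → 20 ℕ.* (q ℕ.+ q) ℕ.≤ 200 ℕ.* (3 ℕ.* (1 ℕ.* q) ℕ.* 1)
          counted q = ℕ.≤-trans (ℕ.m≤m+n _ (560 ℕ.* q)) (ℕ.≤-reflexive (eq′ q))
            where
            eq′ : ∀ q → 20 ℕ.* (q ℕ.+ q) ℕ.+ 560 ℕ.* q ≡ 200 ℕ.* (3 ℕ.* (1 ℕ.* q) ℕ.* 1)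
            eq′ = ℕ-Solver.solve-∀

  rlf≤200S : r * l * f ≤ ι (200 ℕ.* S)
  rlf≤200S = by-scales (proj₁ ⌊log⌋en) (proj₁ (proj₂ ⌊log⌋en)) (proj₂ (proj₂ ⌊log⌋en))
    where
    ⌊log⌋en = floor-log (<⇒≤ 1<en)
    by-scales : ∀ λ′ → ι (2 ℕ.^ λ′) ≤ e * ι n → e * ι n < ι (2 ℕ.^ ℕ.suc λ′) → Goal
    by-scales (ℕ.suc λ′) below above = many-scales λ′ below above
    by-scales ℕ.zero     below above = by-universe (1ℚ ≤? ι 4 * (b * ι U))
      where
      by-universe : Dec (1ℚ ≤ ι 4 * (b * ι U)) → Goal
      by-universe (yes 1≤4bU) = one-scale below above 1≤4bU
      by-universe (no  1≰4bU) = small-universe below (<⇒≤ (≰⇒> 1≰4bU))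

-- Taking products, reciprocals and logarithms of cuts apart.

module CutProducts where

  open import Data.Integer.Base using (+_; +[1+_]; -[1+_])
  open import Data.Rational.Base
  open import Data.Rational.Properties
  open Defs using (_^_)
  open RationalArithmetic
  open CutBounds
  open Logarithms using (0≤^)
  open RingSolver using (solve-∀)

  lower-max : ∀ {x a b} → lower x a → lower x b → ∃ λ c → lower x c × a ≤ c × b ≤ c
  lower-max {x} {a} {b} xa xb with ≤-total a b
  ... | inj₁ a≤b = b , xb , a≤b , ≤-refl
  ... | inj₂ b≤a = a , xa , ≤-refl , b≤a

  upper-min : ∀ {x a b} → upper x a → upper x b → ∃ λ c → upper x c × c ≤ a × c ≤ b
  upper-min {x} {a} {b} xa xb with ≤-total a b
  ... | inj₁ a≤b = a , xa , ≤-refl , a≤b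
  ... | inj₂ b≤a = b , xb , b≤a , ≤-refl

  -- Nonnegativity of a cut, phrased so that it passes directly through the subexpressions of the
  -- bound.
  UpperPositive : Cut → Set
  UpperPositive x = ∀ {a} → upper x a → 0ℚ < a

  ⊗-upperPositive : ∀ {x y} → UpperPositive x → UpperPositive y → UpperPositive (x ⊗ y)
  ⊗-upperPositive x⁺ y⁺ (_ , b′ , _ , c′ , (_ , xb′ , _ , yc′) , (_ , _ , _ , b′c′<a)) =
    <-trans (0<* (x⁺ xb′) (y⁺ yc′)) b′c′<a

  recip-upperPositive : ∀ {x} → UpperPositive (recip x)
  recip-upperPositive (b , 0<b , _ , 1<ab) = 0<*⇒0<ˡ 0<b (<-trans (positive⁻¹ 1ℚ) 1<ab)

  -- Of the four corners two suffice: `a < b′ * c` with `b′` positive forces `c` to be positive, and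
  -- then `a < b * c` forces `b` to be positive.
  ⊗-lower : ∀ {x y a} → UpperPositive x → 0ℚ ≤ a → lower (x ⊗ y) a →
    ∃₂ λ b c → lower x b × lower y c × 0ℚ < b × 0ℚ < c × a < b * c
  ⊗-lower x⁺ 0≤a (b , b′ , c , c′ , (xb , xb′ , yc , yc′) , (a<bc , _ , a<b′c , _)) =
    b , c , xb , yc , 0<*⇒0<ˡ 0<c (≤-<-trans 0≤a a<bc) , 0<c , a<bc
    where
    0<c : 0ℚ < c
    0<c = 0<*⇒0<ʳ (x⁺ xb′) (≤-<-trans 0≤a a<b′c)

  private
    1≤^ : ∀ {w} n → 1ℚ ≤ w → 1ℚ ≤ w ^ n
    1≤^ ℕ.zero    _   = ≤-refl
    1≤^ (ℕ.suc n) 1≤w = *-mono-≤ {1ℚ} 0≤1 (≤-trans 0≤1 (1≤^ n 1≤w)) 1≤w (1≤^ n 1≤w)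
      where
      0≤1 : 0ℚ ≤ 1ℚ
      0≤1 = from-yes (0ℚ ≤? 1ℚ)

    ½^≤1 : ∀ k → ½ ^ k ≤ 1ℚ
    ½^≤1 ℕ.zero    = ≤-refl
    ½^≤1 (ℕ.suc k) = *-mono-≤ {½} {1ℚ} {1ℚ} (from-yes (0ℚ ≤? ½)) (from-yes (0ℚ ≤? 1ℚ)) (from-yes (½ ≤? 1ℚ)) (½^≤1 k)

  log₂-upperPositive : ∀ {z} → (∀ {w} → upper z w → 1ℚ ≤ w) → UpperPositive (log₂ z)
  log₂-upperPositive 1≤z {mkℚ +[1+ p ] d c} _ = positive⁻¹ (mkℚ +[1+ p ] d c)
  log₂-upperPositive 1≤z {mkℚ (+ 0) d _} (w , _ , zw , w^d<1) =
    contradiction (<-≤-trans w^d<1 (1≤^ (ℕ.suc d) (1≤z zw))) (<-irrefl refl)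
  log₂-upperPositive 1≤z {mkℚ -[1+ p ] d _} (w , _ , zw , w^d<2^) =
    contradiction (<-≤-trans w^d<2^ (≤-trans (½^≤1 (ℕ.suc p)) (1≤^ (ℕ.suc d) (1≤z zw)))) (<-irrefl refl)

  opaque
    unfolding ι

    fromℕ-lower : ∀ {m a} → lower (fromℕ m) a → a < ι m
    fromℕ-lower a<m = a<m

    fromℕ-upper : ∀ {m a} → upper (fromℕ m) a → ι m < a
    fromℕ-upper m<a = m<a

    1/200*200 : ∀ s → + 1 / 200 * (ι 200 * s) ≡ s
    1/200*200 = solve-∀ ring

  lower-ε⊗fromℕ : ∀ {ε m a} → UpperPositive ε → 0ℚ ≤ a → lower (ε ⊗ fromℕ m) a →
    ∃ λ e → lower ε e × 0ℚ < e × a < e * ι m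
  lower-ε⊗fromℕ {m = m} ε⁺ 0≤a εm =
    let e , c , εe , c<m , 0<e , _ , a<ec = ⊗-lower ε⁺ 0≤a εm
    in e , εe , 0<e , <-trans a<ec (*-monoʳ-< 0<e (fromℕ-lower {m} c<m))

  upper-ε⊗fromℕ : ∀ {ε m e a} → IsReal ε → UpperPositive ε → lower ε e → upper (ε ⊗ fromℕ m) a → e * ι m < a
  upper-ε⊗fromℕ {m = m} E ε⁺ εe (_ , b′ , _ , c′ , (_ , εb′ , _ , m<c′) , (_ , _ , _ , b′c′<a)) =
    ≤-<-trans (*-monoˡ-≤ (0≤ι m) (<⇒≤ (lower<upper E εe εb′)))
              (<-trans (*-monoʳ-< (ε⁺ εb′) (fromℕ-upper {m} m<c′)) b′c′<a)

-- Assembling the bound for real parameters.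

module LowerBound where

  open import Data.Integer.Base using (+_)
  open import Data.Rational.Base
  open import Data.Rational.Properties
  open RationalArithmetic
  open CutBounds
  open CutProducts

  -- `≤ᶜ` is a negation, so a rational `s` between `S` and the bound is to be refuted. Repeated use
  -- of `⊗-lower` splits it into rational lower bounds of the factors. Each factor brings its own
  -- bracket of ε; `lower-max` and `upper-min` merge them into one `e` and one `b`, as `Endgame`
  -- requires.
  memory-lower-bound : ∀ {ε δ n U S} → IsReal ε → IsReal δ → (A : Algorithm U S) →
    fromℚ 0ℚ <ᶜ ε → ε <ᶜ fromℚ (+ 1 / 80) → δ <ᶜ fromℚ (+ 1 / 10) →
    fromℕ 1 <ᶜ ε ⊗ fromℕ n → 2 ℕ.≤ U → SolvesAQ ε δ n U A →
    fromℚ (+ 1 / 200) ⊗ (recip ε ⊗ log₂ (ε ⊗ fromℕ n) ⊗ log₂ (ε ⊗ fromℕ U ⊘ log₂ (ε ⊗ fromℕ n))) ≤ᶜ fromℕ S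
  memory-lower-bound {ε} {δ} {n} {U} {S} E D A (e₀ , 0<e₀ , εe₀) (b₀ , εb₀ , b₀<ε₀)
    (a , δa , a<⅒) (m , 1<m , εn>m) 2≤U solves
    (s , S<s , s<bound) =
    let
      c , p , c<1/200 , p<x , 0<c , 0<p , s<cp = ⊗-lower {fromℚ (+ 1 / 200)} (<-trans (positive⁻¹ (+ 1 / 200))) 0≤s s<bound
      q , f , q<x , f<log , 0<q , 0<f , p<qf =
        ⊗-lower (⊗-upperPositive (recip-upperPositive {ε}) (log₂-upperPositive {ε ⊗ fromℕ n} 1≤upper)) (<⇒≤ 0<p) p<x
      r , l , (b₁ , 0<b₁ , εb₁ , rb₁<1) , (w , 0<w , w<εn , 2^l<w) , 0<r , 0<l , q<rl =
        ⊗-lower (recip-upperPositive {ε}) (<⇒≤ 0<q) q<x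
      w′ , 0<w′ , w′<εU/log , 2^f<w′ = f<log
      g , h , g<εU , (b₂ , 0<b₂ , (w₂ , 0<w₂ , εn<w₂ , w₂<2^b₂) , hb₂<1) , 0<g , 0<h , w′<gh =
        ⊗-lower (⊗-upperPositive ε⁺ (fromℕ⁺ U)) (<⇒≤ 0<w′) w′<εU/log
      e₁ , εe₁ , 0<e₁ , w<e₁n = lower-ε⊗fromℕ {m = n} ε⁺ (<⇒≤ 0<w) w<εn
      e₂ , εe₂ , 0<e₂ , g<e₂U = lower-ε⊗fromℕ {m = U} ε⁺ (<⇒≤ 0<g) g<εU
      e , εe , e₁≤e , e₃≤e = lower-max {ε} εe₁ εe₃
      b , εb , b≤b₀ , b≤b₁ = upper-min {ε} εb₀ εb₁
      0<e = <-≤-trans 0<e₁ e₁≤e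
      in-n = λ {e′} (e′≤e : e′ ≤ e) → *-monoˡ-≤ {ι n} (0≤ι n) e′≤e
      U-pos : ℕ.NonZero U
      U-pos = ℕ.>-nonZero (ℕ.≤-trans (ℕ.s≤s ℕ.z≤n) 2≤U)
      rlf≤ = Endgame.rlf≤200S {e} {b} {r} {l} {f} {h} {b₂} {w} {w₂} {w′} {n} {U} {S}
        0<e (lower<upper E εe εb) (≤-<-trans b≤b₀ b₀<ε₀)
        (<-≤-trans 1<e₃n (in-n e₃≤e))
        0<r (≤-<-trans (*-monoʳ-≤ (<⇒≤ 0<r) b≤b₁) rb₁<1)
        0<l 2^l<w 0<w (<-≤-trans w<e₁n (in-n e₁≤e))
        0<b₂ w₂<2^b₂ (upper-ε⊗fromℕ {m = n} E ε⁺ εe εn<w₂)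
        0<h hb₂<1 0<f 2^f<w′ 0<w′
        (<-≤-trans w′<gh (*-monoˡ-≤ (<⇒≤ 0<h) (≤-trans (<⇒≤ g<e₂U) (*-monoˡ-≤ (0≤ι U) (<⇒≤ (lower<upper E εe₂ εb))))))
        2≤U
        (MemoryBits.many-bits {{U-pos}} A E 0<e εe εb D δa a<⅒ solves)
        (MemoryBits.one-bit {{U-pos}} A E 0<e εe εb D δa a<⅒ solves)
    in <-irrefl refl (begin-strict
      ι S                                  <⟨ fromℕ-upper {S} S<s ⟩
      s                                    <⟨ s<cp ⟩
      c * p                                ≤⟨ *-monoʳ-≤ (<⇒≤ 0<c) (<⇒≤ p<qf) ⟩
      c * (q * f)
        ≤⟨ *-mono-≤ (<⇒≤ 0<c) (0≤* (0≤* (<⇒≤ 0<r) (<⇒≤ 0<l)) (<⇒≤ 0<f)) (<⇒≤ c<1/200) (*-monoˡ-≤ (<⇒≤ 0<f) (<⇒≤ q<rl)) ⟩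
      + 1 / 200 * (r * l * f)              ≤⟨ *-monoʳ-≤ {+ 1 / 200} (nonNegative⁻¹ (+ 1 / 200)) rlf≤ ⟩
      + 1 / 200 * ι (200 ℕ.* S)            ≡⟨ cong (+ 1 / 200 *_) (ι-* 200 S) ⟩
      + 1 / 200 * (ι 200 * ι S)            ≡⟨ 1/200*200 (ι S) ⟩
      ι S                                  ∎)
    where
    open ≤-Reasoning
    0≤s : 0ℚ ≤ s
    0≤s = ≤-trans (0≤ι S) (<⇒≤ (fromℕ-upper {S} S<s))
    ε⁺ : UpperPositive ε
    ε⁺ εb = <-trans 0<e₀ (lower<upper E εe₀ εb)
    fromℕ⁺ : ∀ m → UpperPositive (fromℕ m)
    fromℕ⁺ m m<b = ≤-<-trans (0≤ι m) (fromℕ-upper {m} m<b)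
    coarse : ∃ λ e → lower ε e × 0ℚ < e × m < e * ι n
    coarse = lower-ε⊗fromℕ {m = n} ε⁺ (<⇒≤ (<-trans (positive⁻¹ 1ℚ) 1<m)) εn>m
    εe₃ = proj₁ (proj₂ coarse)
    1<e₃n : 1ℚ < proj₁ coarse * ι n
    1<e₃n = <-trans 1<m (proj₂ (proj₂ (proj₂ coarse)))
    1≤upper : ∀ {w} → upper (ε ⊗ fromℕ n) w → 1ℚ ≤ w
    1≤upper εn<w = <⇒≤ (<-trans 1<e₃n (upper-ε⊗fromℕ {m = n} E ε⁺ εe₃ εn<w))

open import Data.Integer.Base using (+_)
open import Data.Nat.Base using (_≤_)
open import Data.Rational.Base using (_<_; _/_)

theorem5p1 : ∃ λ (ε₀ : ℚ) → 0ℚ < ε₀ ×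
    ∃ λ (c : ℚ) → 0ℚ < c ×
    ((ε δ : Cut) → IsReal ε → IsReal δ →
    (n U S : ℕ) (A : Algorithm U S) →
    fromℚ 0ℚ <ᶜ ε → ε <ᶜ fromℚ ε₀ →
    δ <ᶜ fromℚ (+ 1 / 10) →
    fromℕ 1 <ᶜ ε ⊗ fromℕ n →
    2 ≤ U →
    SolvesAQ ε δ n U A →
    fromℚ c ⊗ (recip ε ⊗ log₂ (ε ⊗ fromℕ n) ⊗ log₂ (ε ⊗ fromℕ U ⊘ log₂ (ε ⊗ fromℕ n))) ≤ᶜ fromℕ S)
theorem5p1 =
  -- 80 = 8 · 10: the 8 from the quantile error, the 10 from making nine tenths of the letters an
  -- integer.
  + 1 / 80  , ℚ.positive⁻¹ (+ 1 / 80) ,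
  -- The tightest case, `one-scale`, asks for 160; the rest is margin.
  + 1 / 200 , ℚ.positive⁻¹ (+ 1 / 200) ,
  λ ε δ E D n U S → LowerBound.memory-lower-bound E D
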